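{- Every subcubic graph $G$ has a packing $(1,1,2,2,3)$-coloring.
   Context: Graphs are finite and simple. A graph is subcubic if its maximum degree is at most $3$. The distance between two vertices is the number of edges of a shortest path between them (infinite if they lie in different components). For a non-decreasing sequence $S=(s_1,\ldots,s_k)$ of positive integers, a packing $S$-coloring of a graph $G$ is a partition of $V(G)$ into $V_1,\ldots,V_k$ (parts may be empty) such that for every $1\le i\le k$ and every pair of distinct vertices $u,v\in V_i$, the distance between $u$ and $v$ in $G$ is at least $s_i+1$. -}

module Defs where

open import Data.Fin using (Fin)
open import Data.Fin.Subset using (Subset; ∣_∣)
open import Data.List using (List; []; _∷_; map; allFin)
open import Data.List.Extrema.Nat using (max)
open import Data.List.Relation.Unary.Unique.Propositional using (Unique)
open import Data.Nat using (ℕ; zero; suc; _≤_)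
open import Data.Product using (Σ-syntax; ∃-syntax; _×_)
open import Data.Vec using (Vec; lookup; tabulate)
open import Relation.Binary using (Symmetric; Irreflexive; Decidable)
open import Relation.Binary.PropositionalEquality using (_≡_; _≢_)
open import Relation.Nullary using (does)

record Graph (n : ℕ) : Set₁ where
  field
    Adj    : Fin n → Fin n → Set
    adj?   : Decidable Adj
    sym    : Symmetric Adj
    irrefl : Irreflexive _≡_ Adj

module _ {n : ℕ} (G : Graph n) where
  open Graph G

  neighbours : Fin n → Subset n
  neighbours v = tabulate (λ w → does (adj? v w))

  degree : Fin n → ℕ
  degree v = ∣ neighbours v ∣

  -- The graph with no vertices has maximum degree 0.
  maxDegree : ℕ
  maxDegree = max 0 (map degree (allFin n))

  Subcubic : Set
  Subcubic = maxDegree ≤ 3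

  data Walk : Fin n → Fin n → Set where
    nil  : ∀ {u} → Walk u u
    cons : ∀ {u v w} → Adj u v → Walk v w → Walk u w

  length : ∀ {u v} → Walk u v → ℕ
  length nil        = zero
  length (cons _ p) = suc (length p)

  vertices : ∀ {u v} → Walk u v → List (Fin n)
  vertices {u} nil        = u ∷ []
  vertices {u} (cons _ p) = u ∷ vertices p

  IsPath : ∀ {u v} → Walk u v → Set
  IsPath p = Unique (vertices p)

  IsDistance : Fin n → Fin n → ℕ → Set
  IsDistance u v d =
    (Σ[ p ∈ Walk u v ] IsPath p × length p ≡ d) ×
    (∀ (p : Walk u v) → IsPath p → d ≤ length p)

  -- Vertices in different components have no `IsDistance` value; their distance
  -- is infinite and the condition holds vacuously.
  DistanceAtLeast : ℕ → Fin n → Fin n → Set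
  DistanceAtLeast m u v = ∀ d → IsDistance u v d → m ≤ d

  -- A partition into k labelled, possibly empty parts is given by the map c
  -- sending each vertex to the index of its part: V_i = c⁻¹(i).
  IsPackingColoring : ∀ {k} → Vec ℕ k → (Fin n → Fin k) → Set
  IsPackingColoring S c =
    ∀ i u v → c u ≡ i → c v ≡ i → u ≢ v → DistanceAtLeast (suc (lookup S i)) u v

  -- Meant for S non-decreasing with positive entries; the definition itself does
  -- not depend on these properties.
  HasPackingColoring : ∀ {k} → Vec ℕ k → Set
  HasPackingColoring {k} S = ∃[ c ] IsPackingColoring {k} S c

{-# OPTIONS --safe #-}

-- Take a maximum cut f. Its monochromatic edges form a matching, and a set R with one end of each of them
-- leaves a bipartite graph, coloured 0 and 1 by f. Among all such pairs (f, R) minimise the total weight e R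
-- of the pairs of R at distance at most two. Let H be the graph of these pairs.
--
-- Vertices of R with at most one H-neighbour are peeled off and get one of the two 2-packing colours when
-- they are put back. When every remaining vertex has two H-neighbours, a token is removed and gets the
-- 3-packing colour. It is chosen as a vertex of a triangle of H around one vertex of G (star), or as
-- the neighbour d of the partner of another remaining vertex (head), or else on a cycle of H (ring).
--
-- Two tokens have distance at least four. Moving a connected set S to the other side cannot lower the number
-- of monochromatic edges. Each token lies in a set for which this number does not grow, and if two tokens are
-- close, then either the union of their sets and a joining path improves the cut, or both tokens can be
-- replaced by the two inner vertices of the path between them, which lowers e R.
module Submission where

open import Defs
import Algebra.Properties.CommutativeMonoid.Sum
open import Data.Bool using (Bool; true; false; not; if_then_else_)
import Data.Bool.Properties as Boolₚ
open import Data.Empty using (⊥; ⊥-elim)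
open import Data.Fin using (Fin; zero; suc; #_)
open import Data.Fin.Properties using (_≟_; any?; all?)
open import Data.Fin.Subset using (Subset; ∣_∣)
open import Data.Fin.Subset.Properties using (anySubset?)
open import Data.List as List using (List; []; _∷_)
open import Data.List.Extrema.Nat using (xs≤max)
open import Data.List.Membership.Propositional.Properties using (∈-map⁺; ∈-allFin)
open import Data.List.Relation.Unary.All as All using (All; []; _∷_)
open import Data.List.Relation.Unary.Unique.Propositional using (Unique; []; _∷_)
open import Data.Nat using (ℕ; zero; suc; _+_; _*_; _≤_; _<_; z≤n; s≤s)
open import Data.Nat.Induction using (<-rec)
import Data.Nat.ListAction as ListAction
open import Data.Nat.Properties
  using (+-0-commutativeMonoid; +-identityʳ; +-mono-≤; +-monoʳ-≤; *-monoʳ-≤; +-cancelˡ-≤; +-cancelʳ-≤; *-cancelˡ-≤;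
         ≤-refl; ≤-trans; ≤-reflexive; ≤-antisym; m≤n+m; <⇒≱; ≮⇒≥; _<?_; _≤?_; module ≤-Reasoning)
open import Data.Nat.Solver using (module +-*-Solver)
open import Data.Product using (∃; _×_; _,_; proj₁; proj₂)
open import Data.Sum using (_⊎_; inj₁; inj₂; [_,_]′)
open import Data.Vec using ([]; _∷_; lookup; tabulate)
open import Data.Vec.Functional using (updateAt)
open import Data.Vec.Functional.Properties using (updateAt-updates; updateAt-minimal)
open import Data.Vec.Properties using (lookup∘tabulate)
open import Function using (_∘_; const)
open import Relation.Binary.PropositionalEquality
  using (_≡_; _≢_; refl; sym; trans; cong; cong₂; subst; _≗_; module ≡-Reasoning)
open import Relation.Nullary using (¬_; Dec; yes; no; does)
open import Relation.Nullary.Decidable using (_×-dec_; _⊎-dec_; _→-dec_; ¬?; map′; decidable-stable)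
open import Relation.Unary using (Decidable)
open Algebra.Properties.CommutativeMonoid.Sum +-0-commutativeMonoid
  using (sum; sum-cong-≗; ∑-distrib-+; sum-replicate-zero)

-- The accounting rests on degree three. A vertex with one crossing edge into the moved set raises
-- `M` by at most 2 when it is moved as well. A vertex of `R` reached by a crossing edge lowers `M`
-- by at least 2, provided that its own partner is unmoved. So sets that alternate between uncovered
-- vertices (hubs) and vertices of `R` break even, and each unexpected adjacency is a gain.
--
-- The obstacle is the proviso on partners. It is secured by exchanges in `R`: the minimality of
-- `e R` forbids the partner of a well-behaved vertex to touch a second vertex of `R`. The record
-- `Clean` collects what is needed of a set in this respect.
--
-- A path d, a, b, d' in which a and b are the partners of the tokens d and d' escapes the cut
-- argument, because moving a and b only breaks even. This is why `e R` is minimised at all. A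
-- neighbour of a star vertex other than the centre is brought into the same situation by flipping
-- the star.

private variable n : ℕ

-- Finite sums

off : Fin n → (Fin n → ℕ) → Fin n → ℕ
off x g = updateAt g x (const 0)

sum-split : (x : Fin n) (g : Fin n → ℕ) → sum g ≡ g x + sum (off x g)
sum-split zero g = refl
sum-split (suc x) g = trans (cong (g zero +_) (sum-split x (g ∘ suc))) (solve 3 (λ a b c → a :+ (b :+ c) := b :+ (a :+ c)) refl (g zero) (g (suc x)) _)
  where open +-*-Solver using (solve; _:+_; _:*_; _:=_; con)

off-cong : (x : Fin n) {g g' : Fin n → ℕ} → (∀ y → y ≢ x → g y ≡ g' y) → off x g ≗ off x g'
off-cong x {g} {g'} eq y with y ≟ x
... | yes refl = trans (updateAt-updates x g) (sym (updateAt-updates x g'))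
... | no y≢x = trans (updateAt-minimal y x g y≢x) (trans (eq y y≢x) (sym (updateAt-minimal y x g' y≢x)))

off-≡ : {x y : Fin n} (g : Fin n → ℕ) → y ≢ x → off x g y ≡ g y
off-≡ {x = x} {y} g y≢x = updateAt-minimal y x g y≢x

sum-off-+ : (x : Fin n) (g g' : Fin n → ℕ) → sum (off x (λ y → g y + g' y)) ≡ sum (off x g) + sum (off x g')
sum-off-+ x g g' = trans (sum-cong-≗ eq) (∑-distrib-+ (off x g) (off x g'))
  where
  eq : off x (λ y → g y + g' y) ≗ λ y → off x g y + off x g' y
  eq y with y ≟ x
  ... | yes refl rewrite updateAt-updates x {const 0} (λ y → g y + g' y) | updateAt-updates x {const 0} g | updateAt-updates x {const 0} g' = refl
  ... | no y≢x = trans (off-≡ _ y≢x) (cong₂ _+_ (sym (off-≡ g y≢x)) (sym (off-≡ g' y≢x)))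

sum-≥ : (g : Fin n → ℕ) {xs : List (Fin n)} → Unique xs → ListAction.sum (List.map g xs) ≤ sum g
sum-≥ g [] = z≤n
sum-≥ g {x ∷ xs} (x∉xs ∷ uniq) = begin
  g x + ListAction.sum (List.map g xs)         ≡⟨ cong (λ ys → g x + ListAction.sum ys) (off-map x∉xs) ⟩
  g x + ListAction.sum (List.map (off x g) xs) ≤⟨ +-monoʳ-≤ (g x) (sum-≥ (off x g) uniq) ⟩
  g x + sum (off x g)                    ≡⟨ sum-split x g ⟨
  sum g                                  ∎
  where
  open ≤-Reasoning
  off-map : {ys : List (Fin _)} → All (x ≢_) ys → List.map g ys ≡ List.map (off x g) ys
  off-map [] = refl
  off-map (x≢y ∷ ps) = cong₂ _∷_ (sym (off-≡ g (x≢y ∘ sym))) (off-map ps)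

sum-0 : (g : Fin n → ℕ) → (∀ y → g y ≡ 0) → sum g ≡ 0
sum-0 {n} g eq = trans (sum-cong-≗ eq) (sum-replicate-zero n)

sum-≤-unique : (g : Fin n → ℕ) (b : ℕ) → (∀ y → g y ≤ b) → (∀ y z → g y ≢ 0 → g z ≢ 0 → y ≡ z) → sum g ≤ b
sum-≤-unique {zero} g b _ _ = z≤n
sum-≤-unique {suc n} g b g≤b uniq with g zero in eq
... | zero = sum-≤-unique (g ∘ suc) b (g≤b ∘ suc) (λ y z p q → suc-inj (uniq (suc y) (suc z) p q))
  where
  suc-inj : {y z : Fin n} → _≡_ {A = Fin (suc n)} (suc y) (suc z) → y ≡ z
  suc-inj refl = refl
... | suc k = ≤-trans (≤-reflexive (trans (cong (suc k +_) (sum-0 (g ∘ suc) zeros)) (trans (+-identityʳ _) (sym eq)))) (g≤b zero)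
  where
  zeros : ∀ y → g (suc y) ≡ 0
  zeros y with g (suc y) in eq'
  ... | zero = refl
  ... | suc _ with uniq zero (suc y) (λ z → case (trans (sym eq) z)) (λ z → case (trans (sym eq') z))
    where
    case : {m : ℕ} → suc m ≢ 0
    case ()
  ... | ()

∑∑ : (Fin n → Fin n → ℕ) → ℕ
∑∑ F = sum (λ x → sum (F x))

module _ (x : Fin n) where

  rest : (Fin n → Fin n → ℕ) → ℕ
  rest F = sum (off x (λ y → sum (off x (F y))))

  rest-cong : {F F' : Fin n → Fin n → ℕ} → (∀ y z → y ≢ x → z ≢ x → F y z ≡ F' y z) → rest F ≡ rest F'
  rest-cong eq = sum-cong-≗ (off-cong x (λ y y≢x → sum-cong-≗ (off-cong x (λ z → eq y z y≢x))))

  -- By symmetry the column of `x` repeats its row, and the two meet in a zero; hence the factor 2.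
  -- Both `M` and `e` have this shape, so a change at one vertex is visible in one row only.
  ∑∑-split : (F : Fin n → Fin n → ℕ) → (∀ y z → F y z ≡ F z y) → F x x ≡ 0 → ∑∑ F ≡ rest F + 2 * sum (F x)
  ∑∑-split F F-sym Fxx≡0 = begin
    ∑∑ F ≡⟨ sum-split x _ ⟩
    sum (F x) + sum (off x (λ y → sum (F y)))
      ≡⟨ cong (sum (F x) +_) (sum-cong-≗ (off-cong x (λ y _ → sum-split x (F y)))) ⟩
    sum (F x) + sum (off x (λ y → F y x + sum (off x (F y))))
      ≡⟨ cong (sum (F x) +_) (sum-off-+ x (λ y → F y x) _) ⟩
    sum (F x) + (sum (off x (λ y → F y x)) + rest F)
      ≡⟨ cong (λ s → sum (F x) + (s + rest F)) col ⟩
    sum (F x) + (sum (F x) + rest F)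
      ≡⟨ solve 2 (λ a b → a :+ (a :+ b) := b :+ con 2 :* a) refl (sum (F x)) (rest F) ⟩
    rest F + 2 * sum (F x) ∎
    where
    open ≡-Reasoning
    open +-*-Solver using (solve; _:+_; _:*_; _:=_; con)
    col : sum (off x (λ y → F y x)) ≡ sum (F x)
    col = begin
      sum (off x (λ y → F y x)) ≡⟨ sum-cong-≗ (off-cong x (λ y _ → F-sym y x)) ⟩
      sum (off x (F x)) ≡⟨ cong (_+ sum (off x (F x))) (sym Fxx≡0) ⟩
      F x x + sum (off x (F x)) ≡⟨ sym (sum-split x (F x)) ⟩
      sum (F x) ∎

⟦_⟧ : {P : Set} → Dec P → ℕ
⟦ d ⟧ = if does d then 1 else 0

⟦⟧-yes : {P : Set} (d : Dec P) → P → ⟦ d ⟧ ≡ 1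
⟦⟧-yes (yes _) _ = refl
⟦⟧-yes (no ¬p) p = ⊥-elim (¬p p)

⟦⟧-no : {P : Set} (d : Dec P) → ¬ P → ⟦ d ⟧ ≡ 0
⟦⟧-no (yes p) ¬p = ⊥-elim (¬p p)
⟦⟧-no (no _) _ = refl

⟦⟧-⇔ : {P Q : Set} (d : Dec P) (e : Dec Q) → (P → Q) → (Q → P) → ⟦ d ⟧ ≡ ⟦ e ⟧
⟦⟧-⇔ (yes p) e f g = sym (⟦⟧-yes e (f p))
⟦⟧-⇔ (no ¬p) e f g = sym (⟦⟧-no e (¬p ∘ g))

-- Vertex sets

infix 4 _∈_ _∉_

_∈_ _∉_ : Fin n → (Fin n → Bool) → Set
x ∈ X = X x ≡ true
x ∉ X = X x ≡ false

∈∉ : {X : Fin n → Bool} {x : Fin n} → x ∈ X → x ∉ X → ⊥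
∈∉ p q with () ← trans (sym p) q

∈∉-≢ : {X : Fin n → Bool} {x y : Fin n} → x ∈ X → y ∉ X → x ≢ y
∈∉-≢ {X = X} p q refl = ∈∉ {X = X} p q

∈? : (X : Fin n → Bool) (x : Fin n) → Dec (x ∈ X)
∈? X x = X x Boolₚ.≟ true

insert remove : Fin n → (Fin n → Bool) → Fin n → Bool
insert x X = updateAt X x (const true)
remove x X = updateAt X x (const false)

∈-insert : {x y : Fin n} (X : Fin n → Bool) → y ∈ insert x X → y ≡ x ⊎ y ∈ X
∈-insert {x = x} {y} X p with y ≟ x
... | yes y≡x = inj₁ y≡x
... | no y≢x = inj₂ (trans (sym (updateAt-minimal y x X y≢x)) p)

insert-∈ : {x y : Fin n} (X : Fin n → Bool) → y ∈ X → y ∈ insert x X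
insert-∈ {x = x} {y} X p with y ≟ x
... | yes refl = updateAt-updates x X
... | no y≢x = trans (updateAt-minimal y x X y≢x) p

∈-remove : {x y : Fin n} (X : Fin n → Bool) → y ∈ remove x X → y ≢ x × y ∈ X
∈-remove {x = x} {y} X p with y ≟ x
... | yes refl with () ← trans (sym p) (updateAt-updates x X)
... | no y≢x = y≢x , trans (sym (updateAt-minimal y x X y≢x)) p

remove-∈ : {x y : Fin n} (X : Fin n → Bool) → y ≢ x → y ∈ X → y ∈ remove x X
remove-∈ {x = x} {y} X y≢x p = trans (updateAt-minimal y x X y≢x) p

bit : Bool → ℕ
bit b = if b then 1 else 0

card : (Fin n → Bool) → ℕ
card X = sum (bit ∘ X)

card-updateAt : (x : Fin n) (X : Fin n → Bool) (φ : Bool → Bool) →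
                card (updateAt X x φ) ≡ bit (φ (X x)) + sum (off x (bit ∘ X))
card-updateAt x X φ = trans (sum-split x _)
  (cong₂ _+_ (cong bit (updateAt-updates x X)) (sum-cong-≗ (off-cong x (λ y y≢x → cong bit (updateAt-minimal y x X y≢x)))))

card-remove : (x : Fin n) (X : Fin n → Bool) → x ∈ X → card X ≡ suc (card (remove x X))
card-remove x X p = trans (sum-split x _) (trans (cong (λ b → bit b + sum (off x (bit ∘ X))) p) (cong suc (sym (card-updateAt x X (const false)))))

card-insert : (x : Fin n) (X : Fin n → Bool) → x ∉ X → card (insert x X) ≡ suc (card X)
card-insert x X p = trans (card-updateAt x X (const true)) (cong suc (sym (trans (sum-split x _) (cong (λ b → bit b + sum (off x (bit ∘ X))) p))))

flip : Fin n → (Fin n → Bool) → Fin n → Bool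
flip x h = updateAt h x not

flip-at : (x : Fin n) (h : Fin n → Bool) → flip x h x ≡ not (h x)
flip-at x h = updateAt-updates x h

flip-off : {x y : Fin n} (h : Fin n → Bool) → y ≢ x → flip x h y ≡ h y
flip-off {x = x} {y} h y≢x = updateAt-minimal y x h y≢x

-- Finite search

Searchable : Set → Set₁
Searchable C = {P : C → Set} → Decidable P → Dec (∃ P)

searchSubset : Searchable (Subset n)
searchSubset P? = anySubset? P?

search-× : {C D : Set} → Searchable C → Searchable D → Searchable (C × D)
search-× s t P? = map′ (λ { (c , d , p) → (c , d) , p }) (λ { ((c , d) , p) → c , d , p }) (s (λ c → t (λ d → P? (c , d))))

argmin : {C : Set} → Searchable C → {P : C → Set} → Decidable P → (m : C → ℕ) → ∃ P →
         ∃ λ c → P c × (∀ d → P d → m c ≤ m d)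
argmin {C} search {P} P? m (c , p) = <-rec (λ k → ∀ c → P c → m c ≡ k → ∃ λ c → P c × (∀ d → P d → m c ≤ m d)) step (m c) c p refl
  where
  step : ∀ k → (∀ {j} → j < k → ∀ c → P c → m c ≡ j → ∃ λ c → P c × (∀ d → P d → m c ≤ m d)) →
         ∀ c → P c → m c ≡ k → ∃ λ c → P c × (∀ d → P d → m c ≤ m d)
  step k rec c p refl with search (λ d → P? d ×-dec (m d <? m c))
  ... | yes (d , q , lt) = rec lt d q refl
  ... | no none = c , p , λ d q → ≮⇒≥ (λ lt → none (d , q , lt))

module Cubic {n : ℕ} (G : Graph n) (deg≤3 : ∀ v → sum (λ w → ⟦ Graph.adj? G v w ⟧) ≤ 3) where
  open Graph G renaming (sym to adj-sym)

  adj-≢ : ∀ {x y} → Adj x y → x ≢ y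
  adj-≢ a refl = irrefl refl a

  degree-bound : ∀ {v} {xs : List (Fin n)} → Unique xs → All (Adj v) xs → List.length xs ≤ 3
  degree-bound {v} {xs} uniq adj = ≤-trans (≤-reflexive (ones adj)) (≤-trans (sum-≥ _ uniq) (deg≤3 v))
    where
    ones : ∀ {ys} → All (Adj v) ys → List.length ys ≡ ListAction.sum (List.map (λ w → ⟦ adj? v w ⟧) ys)
    ones [] = refl
    ones {y ∷ _} (a ∷ as) = cong₂ _+_ (sym (⟦⟧-yes (adj? v y) a)) (ones as)

  -- Monochromatic edges and the effect of flipping one vertex.

  mono? : (h : Fin n → Bool) (x y : Fin n) → Dec (Adj x y × h x ≡ h y)
  mono? h x y = adj? x y ×-dec (h x Boolₚ.≟ h y)

  M : (Fin n → Bool) → ℕ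
  M h = ∑∑ (λ x y → ⟦ mono? h x y ⟧)

  M-cong : ∀ {h h'} → h ≗ h' → M h ≡ M h'
  M-cong {h} {h'} eq = sum-cong-≗ (λ x → sum-cong-≗ (λ y → ⟦⟧-⇔ (mono? h x y) (mono? h' x y)
    (λ { (a , p) → a , trans (sym (eq x)) (trans p (eq y)) })
    (λ { (a , p) → a , trans (eq x) (trans p (sym (eq y))) })))

  module _ (h : Fin n → Bool) (x : Fin n) where

    private
      h' = flip x h

      split : (k : Fin n → Bool) → M k ≡ rest x (λ y z → ⟦ mono? k y z ⟧) + 2 * sum (λ y → ⟦ mono? k x y ⟧)
      split k = ∑∑-split x _
        (λ y z → ⟦⟧-⇔ (mono? k y z) (mono? k z y) (λ { (a , p) → adj-sym a , sym p }) (λ { (a , p) → adj-sym a , sym p }))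
        (⟦⟧-no (mono? k x x) (λ { (a , _) → irrefl refl a }))

      rest-≡ : rest x (λ y z → ⟦ mono? h' y z ⟧) ≡ rest x (λ y z → ⟦ mono? h y z ⟧)
      rest-≡ = rest-cong x (λ y z y≢x z≢x → ⟦⟧-⇔ (mono? h' y z) (mono? h y z)
        (λ { (a , p) → a , trans (sym (flip-off h y≢x)) (trans p (flip-off h z≢x)) })
        (λ { (a , p) → a , trans (flip-off h y≢x) (trans p (sym (flip-off h z≢x))) }))

      pointwise : ∀ y → ⟦ mono? h x y ⟧ + ⟦ mono? h' x y ⟧ ≡ ⟦ adj? x y ⟧
      pointwise y with adj? x y
      ... | no _ = refl
      ... | yes a with h x Boolₚ.≟ h y
      ... | yes p = cong suc (⟦⟧-no (h' x Boolₚ.≟ h' y) (λ q → Boolₚ.not-¬ (sym p) (trans (sym (flip-off h (adj-≢ a ∘ sym))) (trans (sym q) (flip-at x h)))))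
      ... | no ¬p = ⟦⟧-yes (h' x Boolₚ.≟ h' y) (trans (flip-at x h) (trans (sym (Boolₚ.¬-not (¬p ∘ sym))) (sym (flip-off h (adj-≢ a ∘ sym)))))

    -- With a monochromatic and b other edges at `x`, the flip interchanges a and b. Ordered pairs
    -- are counted, so `M` changes by 2(b - a) = 2(a + b) - 4a, which is at most 6 - 4a.
    flip-bound : ∀ {ys} → Unique ys → All (λ y → Adj x y × h x ≡ h y) ys → M h' + 4 * List.length ys ≤ M h + 6
    flip-bound {ys} uniq bad = begin
      M h' + 4 * List.length ys    ≤⟨ +-monoʳ-≤ (M h') (*-monoʳ-≤ 4 many) ⟩
      M h' + 4 * a            ≡⟨ cong (_+ 4 * a) (trans (split h') (cong (_+ 2 * b) rest-≡)) ⟩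
      r + 2 * b + 4 * a       ≡⟨ solve 3 (λ r a b → r :+ con 2 :* b :+ con 4 :* a := r :+ con 2 :* a :+ con 2 :* (a :+ b)) refl r a b ⟩
      r + 2 * a + 2 * (a + b) ≤⟨ +-monoʳ-≤ (r + 2 * a) (*-monoʳ-≤ 2 (≤-trans (≤-reflexive total) (deg≤3 x))) ⟩
      r + 2 * a + 6           ≡⟨ cong (_+ 6) (split h) ⟨
      M h + 6                 ∎
      where
      open ≤-Reasoning
      open +-*-Solver using (solve; _:+_; _:*_; _:=_; con)
      r = rest x (λ y z → ⟦ mono? h y z ⟧)
      a = sum (λ y → ⟦ mono? h x y ⟧)
      b = sum (λ y → ⟦ mono? h' x y ⟧)
      total : a + b ≡ sum (λ y → ⟦ adj? x y ⟧)
      total = trans (sym (∑-distrib-+ (λ y → ⟦ mono? h x y ⟧) (λ y → ⟦ mono? h' x y ⟧))) (sum-cong-≗ pointwise)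
      ones : ∀ {ys} → All (λ y → Adj x y × h x ≡ h y) ys → List.length ys ≡ ListAction.sum (List.map (λ y → ⟦ mono? h x y ⟧) ys)
      ones [] = refl
      ones {y ∷ _} (p ∷ ps) = cong₂ _+_ (sym (⟦⟧-yes (mono? h x y) p)) (ones ps)
      many : List.length ys ≤ a
      many = ≤-trans (≤-reflexive (ones bad)) (sum-≥ _ uniq)

  -- Pairs at distance at most two

  Common : Fin n → Fin n → Set
  Common x y = ∃ λ u → Adj x u × Adj u y

  common? : ∀ x y → Dec (Common x y)
  common? x y = any? (λ u → adj? x u ×-dec adj? u y)

  H : Fin n → Fin n → Set
  H x y = x ≢ y × (Adj x y ⊎ Common x y)

  H? : ∀ x y → Dec (H x y)
  H? x y with x ≟ y
  ... | yes refl = no (λ { (p , _) → p refl })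
  ... | no x≢y = map′ (x≢y ,_) proj₂ (adj? x y ⊎-dec common? x y)

  H-sym : ∀ {x y} → H x y → H y x
  H-sym (p , inj₁ a) = p ∘ sym , inj₁ (adj-sym a)
  H-sym (p , inj₂ (u , a , b)) = p ∘ sym , inj₂ (u , adj-sym b , adj-sym a)

  -- Adjacent pairs weigh less than pairs at distance two; with equal weights the exchange in quiet
  -- would not be strict.

  W : Fin n → Fin n → ℕ
  W x y = if does (adj? x y) then 1 else if does (H? x y) then 2 else 0

  W-adj : ∀ {x y} → Adj x y → W x y ≡ 1
  W-adj {x} {y} a with adj? x y
  ... | yes _ = refl
  ... | no ¬a = ⊥-elim (¬a a)

  W-two : ∀ {x y} → ¬ Adj x y → H x y → W x y ≡ 2
  W-two {x} {y} ¬a p with adj? x y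
  ... | yes a = ⊥-elim (¬a a)
  ... | no _ with H? x y
  ... | yes _ = refl
  ... | no ¬p = ⊥-elim (¬p p)

  W-H : ∀ {x y} → W x y ≢ 0 → H x y
  W-H {x} {y} W≢0 with adj? x y
  ... | yes a = adj-≢ a , inj₁ a
  ... | no _ with H? x y
  ... | yes p = p
  ... | no _ = ⊥-elim (W≢0 refl)

  W-≤2 : ∀ x y → W x y ≤ 2
  W-≤2 x y with does (adj? x y) | does (H? x y)
  ... | true | _ = s≤s z≤n
  ... | false | true = ≤-refl
  ... | false | false = z≤n

  W-¬H : ∀ {x y} → ¬ H x y → W x y ≡ 0
  W-¬H {x} {y} ¬p with adj? x y
  ... | yes a = ⊥-elim (¬p (adj-≢ a , inj₁ a))
  ... | no _ with H? x y
  ... | yes p = ⊥-elim (¬p p)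
  ... | no _ = refl

  W-sym : ∀ x y → W x y ≡ W y x
  W-sym x y with adj? x y
  ... | yes a = sym (W-adj (adj-sym a))
  ... | no ¬a with H? x y
  ... | yes p = sym (W-two (¬a ∘ adj-sym) (H-sym p))
  ... | no ¬p = sym (W-¬H (¬p ∘ H-sym))

  within : (Fin n → Bool) → Fin n → Fin n → ℕ
  within R x y = if R y then W x y else 0

  Deg : (Fin n → Bool) → Fin n → ℕ
  Deg R x = sum (within R x)

  pairs : (Fin n → Bool) → Fin n → Fin n → ℕ
  pairs R x y = if R x then within R x y else 0

  e : (Fin n → Bool) → ℕ
  e R = ∑∑ (pairs R)

  private
    pairs-sym : ∀ R x y → pairs R x y ≡ pairs R y x
    pairs-sym R x y with R x | R y
    ... | true | true = W-sym x y
    ... | true | false = refl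
    ... | false | true = refl
    ... | false | false = refl

    pairs-diag : ∀ R x → pairs R x x ≡ 0
    pairs-diag R x with R x
    ... | true = W-¬H (λ { (p , _) → p refl })
    ... | false = refl

    e-split : ∀ x R → e R ≡ rest x (pairs R) + 2 * sum (pairs R x)
    e-split x R = ∑∑-split x (pairs R) (pairs-sym R) (pairs-diag R x)

    row-∉ : ∀ x R → x ∉ R → sum (pairs R x) ≡ 0
    row-∉ x R p = sum-0 _ (λ y → cong (λ b → if b then within R x y else 0) p)

    row-∈ : ∀ x R R' → x ∈ R → (∀ y → y ≢ x → R y ≡ R' y) → x ∉ R' → sum (pairs R x) ≡ Deg R' x
    row-∈ x R R' p eq q = sum-cong-≗ pt
      where
      pt : ∀ y → pairs R x y ≡ within R' x y
      pt y with y ≟ x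
      ... | yes refl = trans (pairs-diag R x) (cong (λ b → if b then W x x else 0) (sym q))
      ... | no y≢x = trans (cong (λ b → if b then within R x y else 0) p) (cong (λ b → if b then W x y else 0) (eq y y≢x))

    rest-agree : ∀ x R R' → (∀ y → y ≢ x → R y ≡ R' y) → rest x (pairs R) ≡ rest x (pairs R')
    rest-agree x R R' eq = rest-cong x (λ y z y≢x z≢x →
      cong₂ (λ b c → if b then (if c then W y z else 0) else 0) (eq y y≢x) (eq z z≢x))

    e-change : ∀ x R R' → x ∈ R → x ∉ R' → (∀ y → y ≢ x → R y ≡ R' y) → e R ≡ e R' + 2 * Deg R' x
    e-change x R R' p q eq = begin
      e R                                      ≡⟨ e-split x R ⟩
      rest x (pairs R) + 2 * sum (pairs R x)   ≡⟨ cong₂ (λ a b → a + 2 * b) (rest-agree x R R' eq) (row-∈ x R R' p eq q) ⟩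
      rest x (pairs R') + 2 * Deg R' x         ≡⟨ cong (_+ 2 * Deg R' x) (sym e-R') ⟩
      e R' + 2 * Deg R' x                      ∎
      where
      open ≡-Reasoning
      e-R' : e R' ≡ rest x (pairs R')
      e-R' = trans (e-split x R') (trans (cong (λ s → rest x (pairs R') + 2 * s) (row-∉ x R' q)) (+-identityʳ _))

  e-remove : ∀ x R → x ∈ R → e R ≡ e (remove x R) + 2 * Deg (remove x R) x
  e-remove x R p = e-change x R (remove x R) p (updateAt-updates x R) (λ y y≢x → sym (updateAt-minimal y x R y≢x))

  e-insert : ∀ x R → x ∉ R → e (insert x R) ≡ e R + 2 * Deg R x
  e-insert x R p = e-change x (insert x R) R (updateAt-updates x R) p (λ y y≢x → updateAt-minimal y x R y≢x)

  e-cong : ∀ {R R'} → R ≗ R' → e R ≡ e R'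
  e-cong eq = sum-cong-≗ (λ x → sum-cong-≗ (λ y → cong₂ (λ b c → if b then (if c then W x y else 0) else 0) (eq x) (eq y)))

  card-cong : ∀ {R R' : Fin n → Bool} → R ≗ R' → card R ≡ card R'
  card-cong eq = sum-cong-≗ (cong bit ∘ eq)

  -- The choice of the optimal pair.

  Valid : (h R : Fin n → Bool) → Set
  Valid h R = ∀ x y → Adj x y × h x ≡ h y → x ∈ R ⊎ y ∈ R

  Valid? : ∀ h R → Dec (Valid h R)
  Valid? h R = all? (λ x → all? (λ y → mono? h x y →-dec (∈? R x ⊎-dec ∈? R y)))

  Valid-cong : ∀ {h h' R R'} → h ≗ h' → R ≗ R' → Valid h R → Valid h' R'
  Valid-cong eq eq' v x y (a , p) with v x y (a , trans (eq x) (trans p (sym (eq y))))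
  ... | inj₁ q = inj₁ (trans (sym (eq' x)) q)
  ... | inj₂ q = inj₂ (trans (sym (eq' y)) q)

  -- f is a maximum cut, R a smallest set meeting all its monochromatic edges, and e R is minimal.

  record Optimal (f R : Fin n → Bool) : Set where
    field
      valid : Valid f R
      M-min : ∀ h → M f ≤ M h
      card-min : ∀ h R' → M h ≤ M f → Valid h R' → card R ≤ card R'
      e-min : ∀ h R' → M h ≤ M f → Valid h R' → card R' ≤ card R → e R ≤ e R'

  -- Lexicographic minimisation of `M`, `card` and `e`: each stage searches among the minimisers of
  -- the previous one. The search runs over bit vectors, and the bounds pass to arbitrary functions
  -- because all three quantities respect pointwise equality.
  optimum : ∃ λ f → ∃ λ R → Optimal f R
  optimum = f , R , record
    { valid = v₃
    -- Every cut is admissible together with the full vertex set, so validity does not restrict the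
    -- minimum of `M`.
    ; M-min = λ h → subst (M f ≤_) (M-cong (lookup∘tabulate h))
        (≤-trans (≤-reflexive M≡) (min₁ (tabulate h , tabulate (const true)) (λ x y _ → inj₁ (lookup∘tabulate _ x))))
    ; card-min = λ h R' Mh v → subst (card R ≤_) (card-cong (lookup∘tabulate R'))
        (≤-trans (≤-reflexive c≡) (min₂ (tabulate h , tabulate R')
          (vt h R' v , mt h Mh)))
    ; e-min = λ h R' Mh v le → subst (e R ≤_) (e-cong (lookup∘tabulate R'))
        (min₃ (tabulate h , tabulate R')
          ((vt h R' v , mt h Mh) ,
            ≤-trans (≤-reflexive (card-cong (lookup∘tabulate R'))) (≤-trans le (≤-reflexive c≡))))
    }
    where
    C = Subset n × Subset n
    search = search-× searchSubset searchSubset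
    val : C → Set
    val (h , R') = Valid (lookup h) (lookup R')
    val? : Decidable val
    val? (h , R') = Valid? (lookup h) (lookup R')
    mono card' : C → ℕ
    mono (h , _) = M (lookup h)
    card' (_ , R') = card (lookup R')
    stage₁ = argmin search val? mono ((tabulate (const true) , tabulate (const true)) , λ x y _ → inj₁ (lookup∘tabulate _ x))
    c₁ = proj₁ stage₁
    min₁ = proj₂ (proj₂ stage₁)
    P₂ : C → Set
    P₂ c = val c × mono c ≤ mono c₁
    P₂? : Decidable P₂
    P₂? c = val? c ×-dec (mono c ≤? mono c₁)
    stage₂ = argmin search P₂? card' (c₁ , proj₁ (proj₂ stage₁) , ≤-refl)
    c₂ = proj₁ stage₂
    min₂ = proj₂ (proj₂ stage₂)
    P₃ : C → Set
    P₃ c = P₂ c × card' c ≤ card' c₂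
    P₃? : Decidable P₃
    P₃? c = P₂? c ×-dec (card' c ≤? card' c₂)
    stage₃ = argmin search P₃? (λ (_ , R') → e (lookup R')) (c₂ , proj₁ (proj₂ stage₂) , ≤-refl)
    c₃ = proj₁ stage₃
    min₃ = proj₂ (proj₂ stage₃)
    f = lookup (proj₁ c₃)
    R = lookup (proj₂ c₃)
    v₃ = proj₁ (proj₁ (proj₁ (proj₂ stage₃)))
    M≡ : M f ≡ mono c₁
    M≡ = ≤-antisym (proj₂ (proj₁ (proj₁ (proj₂ stage₃)))) (min₁ c₃ v₃)
    c≡ : card R ≡ card' c₂
    c≡ = ≤-antisym (proj₂ (proj₁ (proj₂ stage₃))) (min₂ c₃ (proj₁ (proj₁ (proj₂ stage₃))))
    vt : ∀ h R' → Valid h R' → val (tabulate h , tabulate R')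
    vt h R' = Valid-cong (sym ∘ lookup∘tabulate h) (sym ∘ lookup∘tabulate R')
    mt : ∀ h → M h ≤ M f → M (lookup (tabulate h)) ≤ mono c₁
    mt h le = ≤-trans (≤-reflexive (M-cong (lookup∘tabulate h))) (≤-trans le (≤-reflexive M≡))

  -- Bounds on weighted degrees.

  Deg-≥₂ : ∀ X {x y z} → y ∈ X → z ∈ X → y ≢ z → W x y + W x z ≤ Deg X x
  Deg-≥₂ X {x} {y} {z} p q y≢z = ≤-trans
    (≤-reflexive (cong₂ _+_ (sym (cong (λ b → if b then W x y else 0) p))
      (trans (sym (cong (λ b → if b then W x z else 0) q)) (sym (+-identityʳ _)))))
    (sum-≥ (within X x) ((y≢z ∷ []) ∷ [] ∷ []))

  within-≤2 : ∀ X x y → within X x y ≤ 2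
  within-≤2 X x y with X y
  ... | true = W-≤2 x y
  ... | false = z≤n

  within-H : ∀ X {x y} → within X x y ≢ 0 → y ∈ X × H x y
  within-H X {x} {y} nz with X y
  ... | true = refl , W-H nz
  ... | false = ⊥-elim (nz refl)

  Deg-unique : ∀ {X x} → (∀ {y z} → y ∈ X → z ∈ X → H x y → H x z → y ≡ z) → Deg X x ≤ 2
  Deg-unique {X} {x} uniq = sum-≤-unique (within X x) 2 (within-≤2 X x)
    (λ y z p q → uniq (proj₁ (within-H X p)) (proj₁ (within-H X q)) (proj₂ (within-H X p)) (proj₂ (within-H X q)))

  -- The adjacent vertex `w` weighs at most 1, and the one H-neighbour that may remain weighs at
  -- most 2.
  Deg-except : ∀ {X x w} → Adj x w → (∀ {y z} → y ∈ X → z ∈ X → y ≢ w → z ≢ w → H x y → H x z → y ≡ z) → Deg X x ≤ 3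
  Deg-except {X} {x} {w} xw uniq = ≤-trans (≤-reflexive (sum-split w (within X x)))
    (+-mono-≤ w≤1 (sum-≤-unique g 2 g≤2 (λ y z p q → let (a , b , c) = nz p ; (a' , b' , c') = nz q in uniq b b' a a' c c')))
    where
    g = off w (within X x)
    w≤1 : within X x w ≤ 1
    w≤1 with X w
    ... | true = ≤-reflexive (W-adj xw)
    ... | false = z≤n
    g≤2 : ∀ y → g y ≤ 2
    g≤2 y with y ≟ w
    ... | yes refl = ≤-trans (≤-reflexive (updateAt-updates w (within X x))) z≤n
    ... | no y≢w = ≤-trans (≤-reflexive (off-≡ (within X x) y≢w)) (within-≤2 X x y)
    nz : ∀ {y} → g y ≢ 0 → y ≢ w × y ∈ X × H x y
    nz {y} p with y ≟ w
    ... | yes refl = ⊥-elim (p (updateAt-updates w (within X x)))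
    ... | no y≢w = y≢w , within-H X (p ∘ trans (off-≡ (within X x) y≢w))

  -- Only an inequality, since `x` may lie in `X` already.
  Deg-insert : ∀ X x y → Deg (insert x X) y ≤ W y x + Deg X y
  Deg-insert X x y = begin
    Deg (insert x X) y
      ≡⟨ sum-split x (within (insert x X) y) ⟩
    within (insert x X) y x + sum (off x (within (insert x X) y))
      ≡⟨ cong₂ _+_ (cong (λ b → if b then W y x else 0) (updateAt-updates x X))
                   (sum-cong-≗ (off-cong x (λ z z≢x → cong (λ b → if b then W y z else 0) (updateAt-minimal z x X z≢x)))) ⟩
    W y x + sum (off x (within X y))
      ≤⟨ +-monoʳ-≤ (W y x) (≤-trans (m≤n+m _ _) (≤-reflexive (sym (sum-split x (within X y))))) ⟩
    W y x + Deg X y ∎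
    where open ≤-Reasoning

  -- As degrees are at most three, `a`, `b` and `c` are all the neighbours of `u`. Any two of them
  -- are joined in H.
  record Star (R : Fin n → Bool) (u a b c : Fin n) : Set where
    field
      a∈R : a ∈ R
      b∈R : b ∈ R
      c∈R : c ∈ R
      ua : Adj u a
      ub : Adj u b
      uc : Adj u c
      a≢b : a ≢ b
      a≢c : a ≢ c
      b≢c : b ≢ c

  Star-rot : ∀ {R u a b c} → Star R u a b c → Star R u b c a
  Star-rot s = record { a∈R = b∈R ; b∈R = c∈R ; c∈R = a∈R ; ua = ub ; ub = uc ; uc = ua
                      ; a≢b = b≢c ; a≢c = a≢b ∘ sym ; b≢c = a≢c ∘ sym }
    where open Star s

  -- Consequences of optimality.

  module Structure (f R : Fin n → Bool) (opt : Optimal f R) where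
    open Optimal opt

    Mo Cr : Fin n → Fin n → Set
    Mo x y = Adj x y × f x ≡ f y
    Cr x y = Adj x y × f x ≢ f y

    Mo-sym : ∀ {x y} → Mo x y → Mo y x
    Mo-sym (a , p) = adj-sym a , sym p

    Cr-sym : ∀ {x y} → Cr x y → Cr y x
    Cr-sym (a , p) = adj-sym a , p ∘ sym

    Mo-Cr : ∀ {x y z} → Mo x y → Cr x z → y ≢ z
    Mo-Cr (_ , p) (_ , q) refl = q p

    Mo⊎Cr : ∀ {x y} → Adj x y → Mo x y ⊎ Cr x y
    Mo⊎Cr {x} {y} a with f x Boolₚ.≟ f y
    ... | yes p = inj₁ (a , p)
    ... | no p = inj₂ (a , p)

    Cr-Cr : ∀ {x y z} → Cr x y → Cr y z → f x ≡ f z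
    Cr-Cr (_ , p) (_ , q) = trans (Boolₚ.¬-not p) (sym (Boolₚ.¬-not (q ∘ sym)))

    -- A set S of vertices is represented by the cut h obtained from f by moving S to the other side.

    record In (h : Fin n → Bool) (s : Fin n) : Set where
      constructor moved
      field side : h s ≡ not (f s)

    record Out (h : Fin n → Bool) (s : Fin n) : Set where
      constructor unmoved
      field side : h s ≡ f s

    in? : ∀ h s → In h s ⊎ Out h s
    in? h s with h s Boolₚ.≟ f s
    ... | yes p = inj₂ (unmoved p)
    ... | no p = inj₁ (moved (Boolₚ.¬-not p))

    In-Out : ∀ {h s t} → In h s → Out h t → s ≢ t
    In-Out (moved p) (unmoved q) refl = Boolₚ.not-¬ q p

    out-f : ∀ {s} → Out f s
    out-f = unmoved refl

    In-flip : ∀ {x s h} → In (flip x h) s → s ≡ x ⊎ In h s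
    In-flip {x} {s} {h} (moved p) with s ≟ x
    ... | yes q = inj₁ q
    ... | no q = inj₂ (moved (trans (sym (flip-off h q)) p))

    flip-In : ∀ {x h} → Out h x → In (flip x h) x
    flip-In {x} {h} (unmoved p) = moved (trans (flip-at x h) (cong not p))

    In-keep : ∀ {x s h} → Out h x → In h s → In (flip x h) s
    In-keep {h = h} q (moved p) = moved (trans (flip-off h (In-Out (moved p) q)) p)

    Out-off : ∀ {x s h} → s ≢ x → Out h s → Out (flip x h) s
    Out-off {h = h} q (unmoved p) = unmoved (trans (flip-off h q) p)

    bad-mono : ∀ {h x p} → Out h x → Mo x p → Out h p → Adj x p × h x ≡ h p
    bad-mono (unmoved o) (a , q) (unmoved o') = a , trans o (trans q (sym o'))

    bad-cross : ∀ {h x s} → Out h x → Cr x s → In h s → Adj x s × h x ≡ h s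
    bad-cross (unmoved o) (a , q) (moved i) = a , trans o (trans (Boolₚ.¬-not q) (sym i))

    private
      Bad : (Fin n → Bool) → Fin n → Fin n → Set
      Bad h x y = Adj x y × h x ≡ h y

      step₁ : ∀ {h x y} → Bad h x y → M (flip x h) ≤ 2 + M h
      step₁ {h} {x} b = +-cancelʳ-≤ 4 _ _ (≤-trans (flip-bound h x ([] ∷ []) (b ∷ []))
        (≤-reflexive (solve 1 (λ m → m :+ con 6 := con 2 :+ m :+ con 4) refl (M h))))
        where open +-*-Solver using (solve; _:+_; _:=_; con)

      step₂ : ∀ {h x y z} → y ≢ z → Bad h x y → Bad h x z → 2 + M (flip x h) ≤ M h
      step₂ {h} {x} y≢z b c = +-cancelʳ-≤ 6 _ _ (≤-trans
        (≤-reflexive (solve 1 (λ m → con 2 :+ m :+ con 6 := m :+ con 8) refl (M (flip x h))))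
        (flip-bound h x ((y≢z ∷ []) ∷ [] ∷ []) (b ∷ c ∷ [])))
        where open +-*-Solver using (solve; _:+_; _:=_; con)

      step₃ : ∀ {h x y z w} → y ≢ z → y ≢ w → z ≢ w → Bad h x y → Bad h x z → Bad h x w → 6 + M (flip x h) ≤ M h
      step₃ {h} {x} y≢z y≢w z≢w b c d = +-cancelʳ-≤ 6 _ _ (≤-trans
        (≤-reflexive (solve 1 (λ m → con 6 :+ m :+ con 6 := m :+ con 12) refl (M (flip x h))))
        (flip-bound h x ((y≢z ∷ y≢w ∷ []) ∷ (z≢w ∷ []) ∷ [] ∷ []) (b ∷ c ∷ d ∷ [])))
        where open +-*-Solver using (solve; _:+_; _:=_; con)

    -- M counts every monochromatic edge twice, so the excess k of h over f is even. Adding a vertex to S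
    -- changes it by 6 - 4j at most, where j counts its monochromatic edges in h.

    record Low (h : Fin n → Bool) (k : ℕ) : Set where
      constructor low
      field bound : M h ≤ k + M f

    none : ∀ h {k} → ¬ (suc k + M h ≤ M f)
    none h {k} p = <⇒≱ (≤-trans (s≤s (m≤n+m (M h) k)) p) (M-min h)

    start : ∀ {x p} → Mo x p → Low (flip x f) 2
    start {x} m = low (step₁ {f} {x} m)

    rise : ∀ {h x s} → Out h x → Cr x s → In h s → M (flip x h) ≤ 2 + M h
    rise {h} o c i = step₁ {h} (bad-cross o c i)

    add₁ : ∀ {h k x s} → Low h k → Out h x → Cr x s → In h s → Low (flip x h) (2 + k)
    add₁ (low l) o c i = low (≤-trans (rise o c i) (+-monoʳ-≤ 2 l))

    drop₂ : ∀ {h x p s} → Out h x → Mo x p → Out h p → Cr x s → In h s → 2 + M (flip x h) ≤ M h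
    drop₂ {h} o m o' c i = step₂ {h} (Mo-Cr m c) (bad-mono o m o') (bad-cross o c i)

    add₂ : ∀ {h k x p s} → Low h (2 + k) → Out h x → Mo x p → Out h p → Cr x s → In h s → Low (flip x h) k
    add₂ (low l) o m o' c i = low (+-cancelˡ-≤ 2 _ _ (≤-trans (drop₂ o m o' c i) l))

    -- The usual end of a cut argument: a set of excess 0 next to one more gain of 2 contradicts the
    -- minimality of `M f`.
    add₂⊥ : ∀ {h x p s} → Low h 0 → Out h x → Mo x p → Out h p → Cr x s → In h s → ⊥
    add₂⊥ {h} {x} (low l) o m o' c i = none (flip x h) (≤-trans (drop₂ o m o' c i) l)

    drop-two : ∀ {h x s t} → Out h x → Cr x s → In h s → Cr x t → In h t → s ≢ t → 2 + M (flip x h) ≤ M h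
    drop-two {h} o c i d j s≢t = step₂ {h} s≢t (bad-cross o c i) (bad-cross o d j)

    two⊥ : ∀ {h x s t} → Low h 0 → Out h x → Cr x s → In h s → Cr x t → In h t → s ≢ t → ⊥
    two⊥ {h} {x} (low l) o c i d j s≢t = none (flip x h) (≤-trans (drop-two o c i d j s≢t) l)

    drop₃ : ∀ {h x p s t} → Out h x → Mo x p → Out h p → Cr x s → In h s → Cr x t → In h t → s ≢ t → 6 + M (flip x h) ≤ M h
    drop₃ {h} o m o' c i d j s≢t = step₃ {h} (Mo-Cr m c) (Mo-Cr m d) s≢t (bad-mono o m o') (bad-cross o c i) (bad-cross o d j)

    -- Three monochromatic edges at `x` give a change of -6, which even an excess of 2 cannot
    -- absorb.
    three⊥ : ∀ {h x p s t} → Low h 2 → Out h x → Mo x p → Out h p → Cr x s → In h s → Cr x t → In h t → s ≢ t → ⊥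
    three⊥ {h} {x} (low l) o m o' c i d j s≢t = none (flip x h) {3} (+-cancelˡ-≤ 2 (4 + M (flip x h)) _ (≤-trans (drop₃ o m o' c i d j s≢t) l))

    -- Flipping a vertex with two monochromatic edges would change `M` by at most 6 - 8.
    Mo-unique : ∀ {x y z} → Mo x y → Mo x z → y ≡ z
    Mo-unique {x} {y} {z} p q with y ≟ z
    ... | yes y≡z = y≡z
    ... | no y≢z = ⊥-elim (none (flip x f) (step₂ {f} y≢z p q))

    -- Covered by the matching of monochromatic edges. The uncovered vertices serve as hubs between
    -- vertices of `R`.
    Cov : Fin n → Set
    Cov x = ∃ λ p → Mo x p

    cov? : ∀ x → Dec (Cov x)
    cov? x = any? (mono? f x)

    private
      remove-valid : ∀ {x} → (∀ {y} → Mo x y → y ∈ R × y ≢ x) → Valid f (remove x R)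
      remove-valid {x} hyp a b ab = aux (valid a b ab)
        where
        aux : a ∈ R ⊎ b ∈ R → a ∈ remove x R ⊎ b ∈ remove x R
        aux q with a ≟ x | b ≟ x
        ... | yes refl | _ = inj₂ (remove-∈ R (proj₂ (hyp ab)) (proj₁ (hyp ab)))
        ... | no a≢x | yes refl = inj₁ (remove-∈ R a≢x (proj₁ (hyp (Mo-sym ab))))
        aux (inj₁ p) | no a≢x | no _ = inj₁ (remove-∈ R a≢x p)
        aux (inj₂ p) | no _ | no b≢x = inj₂ (remove-∈ R b≢x p)

      irredundant : ∀ {x} → x ∈ R → Valid f (remove x R) → ⊥
      irredundant {x} x∈R v = <⇒≱ (≤-reflexive (sym (card-remove x R x∈R))) (card-min f (remove x R) ≤-refl v)

    -- If `y` were in `R`, it would already meet the only monochromatic edge at `x`, and `x` could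
    -- be dropped from `R`.
    Mo-∉ : ∀ {x y} → x ∈ R → Mo x y → y ∉ R
    Mo-∉ {x} {y} x∈R m with R y in eq
    ... | false = refl
    ... | true = ⊥-elim (irredundant x∈R (remove-valid
      (λ m' → subst (_∈ R) (Mo-unique m m') eq , λ { refl → adj-≢ (proj₁ m') refl })))

    -- An uncovered vertex of `R` would meet no monochromatic edge, against the minimality of
    -- `card R`.
    partner : ∀ {x} → x ∈ R → ∃ λ p → Mo x p × p ∉ R
    partner {x} x∈R with cov? x
    ... | yes (p , m) = p , m , Mo-∉ x∈R m
    ... | no ¬c = ⊥-elim (irredundant x∈R (remove-valid (λ m → ⊥-elim (¬c (_ , m)))))

    Mo-∈ : ∀ {x y} → x ∉ R → Mo x y → y ∈ R
    Mo-∈ {x} {y} x∉R m with valid x y m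
    ... | inj₁ p = ⊥-elim (∈∉ {X = R} p x∉R)
    ... | inj₂ p = p

    R-Cr : ∀ {x y} → x ∈ R → y ∈ R → Adj x y → Cr x y
    R-Cr p q a with Mo⊎Cr a
    ... | inj₁ m = ⊥-elim (∈∉ {X = R} q (Mo-∉ p m))
    ... | inj₂ c = c

    B-Cr : ∀ {x y} → x ∉ R → y ∉ R → Adj x y → Cr x y
    B-Cr p q a with Mo⊎Cr a
    ... | inj₁ m = ⊥-elim (∈∉ {X = R} (Mo-∈ p m) q)
    ... | inj₂ c = c

    uncov-∉ : ∀ {x} → ¬ Cov x → x ∉ R
    uncov-∉ {x} ¬c with R x in eq
    ... | false = refl
    ... | true = ⊥-elim (¬c (_ , proj₁ (proj₂ (partner eq))))

    uncov-Cr : ∀ {x y} → ¬ Cov x → Adj x y → Cr x y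
    uncov-Cr ¬c a with Mo⊎Cr a
    ... | inj₁ m = ⊥-elim (¬c (_ , m))
    ... | inj₂ c = c

    Cr-≢Mo : ∀ {x p y} → Mo x p → Adj x y → y ≢ p → Cr x y
    Cr-≢Mo m a y≢p with Mo⊎Cr a
    ... | inj₁ m' = ⊥-elim (y≢p (Mo-unique m' m))
    ... | inj₂ c = c

    -- Moving `x` costs 2, and moving `p` and `q` then gains 2 each. The last hypothesis keeps the
    -- partner of `q` unmoved; neither partner is `x`, because `xp` and `xq` cross.
    cherry : ∀ {x p q p' q'} → Cov x → Cr x p → Cr x q → Mo p p' → Mo q q' → p ≢ q → q' ≢ p → ⊥
    cherry {x} {p} {q} {p'} {q'} (x' , mx) cp cq mp mq p≢q q'≢p = add₂⊥ l₁
      (Out-off (p≢q ∘ sym) (Out-off (adj-≢ (proj₁ cq) ∘ sym) out-f)) mq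
      (Out-off q'≢p (Out-off (Mo-Cr mq (Cr-sym cq)) out-f))
      (Cr-sym cq) (In-keep p-out (flip-In out-f))
      where
      p-out : Out (flip x f) p
      p-out = Out-off (adj-≢ (proj₁ cp) ∘ sym) out-f
      l₁ : Low (flip p (flip x f)) 0
      l₁ = add₂ (start mx) p-out mp (Out-off (Mo-Cr mp (Cr-sym cp)) out-f) (Cr-sym cp) (flip-In out-f)

    -- For `q` in `R` a partner exists. If it were `p`, uniqueness would make `q` the partner of
    -- `p`, which the last hypothesis excludes.
    cherry-R : ∀ {x p q p'} → Cov x → Cr x p → Cr x q → Mo p p' → q ∈ R → p ≢ q → p' ≢ q → ⊥
    cherry-R c cp cq mp q∈R p≢q p'≢q with partner q∈R
    ... | q' , mq , _ = cherry c cp cq mp mq p≢q (λ { refl → p'≢q (Mo-unique mp (Mo-sym mq)) })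

    nbrs : ∀ {v a b c d} → Adj v a → Adj v b → Adj v c → Adj v d → a ≢ b → a ≢ c → b ≢ c → d ≢ a → d ≢ b → d ≡ c
    nbrs {c = c} {d} va vb vc vd a≢b a≢c b≢c d≢a d≢b with d ≟ c
    ... | yes p = p
    ... | no d≢c = ⊥-elim (<⇒≱ ≤-refl (degree-bound
      ((a≢b ∷ a≢c ∷ (d≢a ∘ sym) ∷ []) ∷ (b≢c ∷ (d≢b ∘ sym) ∷ []) ∷ ((d≢c ∘ sym) ∷ []) ∷ [] ∷ [])
      (va ∷ vb ∷ vc ∷ vd ∷ [])))

    -- Exchanges

    private
      valid-from : ∀ {R'} → (∀ {a b} → a ∈ R → Mo a b → a ∈ R' ⊎ b ∈ R') → Valid f R'
      valid-from hyp a b ab with valid a b ab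
      ... | inj₁ p = hyp p ab
      ... | inj₂ p with hyp p (Mo-sym ab)
      ...   | inj₁ q = inj₂ q
      ...   | inj₂ q = inj₁ q

    -- Putting `m` in place of `z` gives a valid set of the same size. Minimality of `e R` compares
    -- the two, and all pairs that avoid both vertices cancel.
    exchange₁ : ∀ {z m} → z ∈ R → Mo z m → Deg (remove z R) z ≤ Deg (remove z R) m
    exchange₁ {z} {m} z∈R zm = *-cancelˡ-≤ 2 (+-cancelˡ-≤ (e R₀) _ _ (begin
      e R₀ + 2 * Deg R₀ z ≡⟨ e-remove z R z∈R ⟨
      e R                 ≤⟨ e-min f R' ≤-refl ok (≤-reflexive same) ⟩
      e R'                ≡⟨ e-insert m R₀ m∉R₀ ⟩
      e R₀ + 2 * Deg R₀ m ∎))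
      where
      open ≤-Reasoning
      R₀ = remove z R
      R' = insert m R₀
      m∉R₀ : m ∉ R₀
      m∉R₀ = trans (updateAt-minimal m z R (λ { refl → adj-≢ (proj₁ zm) refl })) (Mo-∉ z∈R zm)
      same : card R' ≡ card R
      same = trans (card-insert m R₀ m∉R₀) (sym (card-remove z R z∈R))
      ok : Valid f R'
      ok = valid-from aux
        where
        aux : ∀ {a b} → a ∈ R → Mo a b → a ∈ R' ⊎ b ∈ R'
        aux {a} p ab with a ≟ z
        ... | yes refl = inj₂ (subst (_∈ R') (Mo-unique zm ab) (updateAt-updates m R₀))
        ... | no a≢z = inj₁ (insert-∈ R₀ (remove-∈ R a≢z p))

    -- Vertices are removed and inserted one at a time, and the degrees are taken in the
    -- intermediate sets. In this way the pair `z`, `s` is counted once on the left and the pair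
    -- `m`, `t` once on the right.
    exchange₂ : ∀ {z m s t} → z ∈ R → s ∈ R → z ≢ s → Mo z m → Mo s t → let R₀ = remove s (remove z R) in
                Deg (remove z R) z + Deg R₀ s ≤ Deg R₀ m + Deg (insert m R₀) t
    exchange₂ {z} {m} {s} {t} z∈R s∈R z≢s zm st = *-cancelˡ-≤ 2 (+-cancelˡ-≤ (e R₀) _ _ (begin
      e R₀ + 2 * (Deg R₁ z + Deg R₀ s)     ≡⟨ solve 3 (λ a b c → a :+ con 2 :* (b :+ c) := a :+ con 2 :* c :+ con 2 :* b) refl (e R₀) (Deg R₁ z) (Deg R₀ s) ⟩
      e R₀ + 2 * Deg R₀ s + 2 * Deg R₁ z   ≡⟨ cong (_+ 2 * Deg R₁ z) (e-remove s R₁ s∈R₁) ⟨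
      e R₁ + 2 * Deg R₁ z                  ≡⟨ e-remove z R z∈R ⟨
      e R                                  ≤⟨ e-min f R₃ ≤-refl ok (≤-reflexive same) ⟩
      e R₃                                 ≡⟨ e-insert t R₂ t∉R₂ ⟩
      e R₂ + 2 * Deg R₂ t                  ≡⟨ cong (_+ 2 * Deg R₂ t) (e-insert m R₀ m∉R₀) ⟩
      e R₀ + 2 * Deg R₀ m + 2 * Deg R₂ t   ≡⟨ solve 3 (λ a b c → a :+ con 2 :* b :+ con 2 :* c := a :+ con 2 :* (b :+ c)) refl (e R₀) (Deg R₀ m) (Deg R₂ t) ⟩
      e R₀ + 2 * (Deg R₀ m + Deg R₂ t)     ∎))
      where
      open ≤-Reasoning
      open +-*-Solver using (solve; _:+_; _:*_; _:=_; con)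
      R₁ = remove z R
      R₀ = remove s R₁
      R₂ = insert m R₀
      R₃ = insert t R₂
      s∈R₁ : s ∈ R₁
      s∈R₁ = remove-∈ R (z≢s ∘ sym) s∈R
      ∉R₀ : ∀ {x} → x ∉ R → x ∉ R₀
      ∉R₀ {x} x∉R = trans (updateAt-minimal x s R₁ (∈∉-≢ {X = R} s∈R x∉R ∘ sym)) (trans (updateAt-minimal x z R (∈∉-≢ {X = R} z∈R x∉R ∘ sym)) x∉R)
      m∉R₀ = ∉R₀ (Mo-∉ z∈R zm)
      t≢m : t ≢ m
      t≢m refl = z≢s (Mo-unique (Mo-sym zm) (Mo-sym st))
      t∉R₂ : t ∉ R₂
      t∉R₂ = trans (updateAt-minimal t m R₀ t≢m) (∉R₀ (Mo-∉ s∈R st))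
      same : card R₃ ≡ card R
      same = trans (card-insert t R₂ t∉R₂) (trans (cong suc (card-insert m R₀ m∉R₀))
        (sym (trans (card-remove z R z∈R) (cong suc (card-remove s R₁ s∈R₁)))))
      ok : Valid f R₃
      ok = valid-from aux
        where
        aux : ∀ {a b} → a ∈ R → Mo a b → a ∈ R₃ ⊎ b ∈ R₃
        aux {a} p ab with a ≟ z | a ≟ s
        ... | yes refl | _ = inj₂ (subst (_∈ R₃) (Mo-unique zm ab) (insert-∈ R₂ (updateAt-updates m R₀)))
        ... | no _ | yes refl = inj₂ (subst (_∈ R₃) (Mo-unique st ab) (updateAt-updates t R₂))
        ... | no a≢z | no a≢s = inj₁ (insert-∈ R₂ (insert-∈ R₀ (remove-∈ R₁ a≢s (remove-∈ R a≢z p))))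

    -- All H-neighbours of such a vertex in `R` are at distance exactly two and weigh 2, which is
    -- what makes exchanges strict.
    Isolated : Fin n → Set
    Isolated v = ∀ {r} → r ∈ R → ¬ Adj v r

    -- The bound is 1 + 2. The vertex `w` weighs 1. By `cherry`, any other H-neighbour of `m` in `X`
    -- lies behind the third neighbour t of `m`, and t is uncovered. Behind t there is only one,
    -- since moving `m`, `w`, t and two such vertices would change `M` by 2 - 2 + 2 - 2 - 2.
    deg-head : ∀ {z m w X} → z ∈ R → Mo z m → Adj m w → w ∈ R → w ≢ z →
               (∀ {y} → y ∈ X → y ∈ R × y ≢ z × ¬ Adj z y) → Deg X m ≤ 3
    deg-head {z} {m} {w} {X} z∈R zm mw w∈R w≢z X⊆ = Deg-except mw unique
      where
      mz = Mo-sym zm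
      m∉R = Mo-∉ z∈R zm
      mw× = Cr-≢Mo mz mw w≢z
      w' = proj₁ (partner w∈R)
      ww' = proj₁ (proj₂ (partner w∈R))
      w'∉R = proj₂ (proj₂ (partner w∈R))

      via : ∀ {y} → y ∈ X → y ≢ w → H m y → ∃ λ t → Adj m t × t ≢ z × t ≢ w × ¬ Cov t × Adj t y
      via {y} y∈X y≢w (_ , inj₁ my) = ⊥-elim (cherry-R (z , mz) mw× (Cr-≢Mo mz my y≢z) ww' y∈R (y≢w ∘ sym) (∈∉-≢ {X = R} y∈R w'∉R ∘ sym))
        where
        y∈R = proj₁ (X⊆ y∈X)
        y≢z = proj₁ (proj₂ (X⊆ y∈X))
      via {y} y∈X y≢w (_ , inj₂ (t , mt , ty)) with t ≟ z | t ≟ w | cov? t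
      ... | yes refl | _ | _ = ⊥-elim (proj₂ (proj₂ (X⊆ y∈X)) ty)
      ... | no _ | yes refl | _ = ⊥-elim (cherry-R (w' , ww') (Cr-sym mw×) (R-Cr w∈R y∈R ty) mz y∈R (∈∉-≢ {X = R} y∈R m∉R ∘ sym) (y≢z ∘ sym))
        where
        y∈R = proj₁ (X⊆ y∈X)
        y≢z = proj₁ (proj₂ (X⊆ y∈X))
      ... | no t≢z | no t≢w | no ¬c = t , mt , t≢z , t≢w , ¬c , ty
      ... | no t≢z | no t≢w | yes (t' , tt') with t' ≟ w
      ...   | no t'≢w = ⊥-elim (cherry (z , mz) mw× (Cr-≢Mo mz mt t≢z) ww' tt' (t≢w ∘ sym) t'≢w)
      -- Here `t` and `w` are partners of each other, so the cherry is taken at `t` instead of `m`.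
      ...   | yes refl = ⊥-elim (cherry-R (w , tt') (Cr-sym (Cr-≢Mo mz mt t≢z)) (Cr-≢Mo tt' ty y≢w) mz y∈R (∈∉-≢ {X = R} y∈R m∉R ∘ sym) (y≢z ∘ sym))
        where
        y∈R = proj₁ (X⊆ y∈X)
        y≢z = proj₁ (proj₂ (X⊆ y∈X))

      unique : ∀ {y₁ y₂} → y₁ ∈ X → y₂ ∈ X → y₁ ≢ w → y₂ ≢ w → H m y₁ → H m y₂ → y₁ ≡ y₂
      unique {y₁} {y₂} p₁ p₂ y₁≢w y₂≢w h₁ h₂ with y₁ ≟ y₂ | via p₁ y₁≢w h₁ | via p₂ y₂≢w h₂
      ... | yes q | _ | _ = q
      ... | no y₁≢y₂ | t , mt , t≢z , t≢w , ¬ct , ty₁ | t₂ , mt₂ , t₂≢z , t₂≢w , _ , ty₂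
        with refl ← nbrs (proj₁ mz) mw mt mt₂ (w≢z ∘ sym) (t≢z ∘ sym) (t≢w ∘ sym) t₂≢z t₂≢w
        = ⊥-elim (contra (partner (proj₁ (X⊆ p₁))) (partner (proj₁ (X⊆ p₂))))
        where
        t∉R = uncov-∉ ¬ct
        ≢m : ∀ {y} → y ∈ R → y ≢ m
        ≢m q = ∈∉-≢ {X = R} q m∉R
        out-w : Out (flip m f) w
        out-w = Out-off (≢m w∈R) out-f
        l₀ : Low (flip w (flip m f)) 0
        l₀ = add₂ (start mz) out-w ww' (Out-off (Mo-Cr ww' (Cr-sym mw×)) out-f) (Cr-sym mw×) (flip-In out-f)
        out-t : Out (flip w (flip m f)) t
        out-t = Out-off t≢w (Out-off (adj-≢ mt ∘ sym) out-f)
        l₁ : Low (flip t (flip w (flip m f))) 2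
        l₁ = add₁ l₀ out-t (uncov-Cr ¬ct (adj-sym mt)) (In-keep out-w (flip-In out-f))
        out-y : ∀ {y} → y ∈ X → y ≢ w → Out (flip t (flip w (flip m f))) y
        out-y q y≢w = Out-off (∈∉-≢ {X = R} (proj₁ (X⊆ q)) t∉R) (Out-off y≢w (Out-off (≢m (proj₁ (X⊆ q))) out-f))
        out-y' : ∀ {y y'} → y ∈ X → Mo y y' → y' ∉ R → Out (flip t (flip w (flip m f))) y'
        out-y' q yy' y'∉R = Out-off (λ { refl → ¬ct (_ , Mo-sym yy') }) (Out-off (∈∉-≢ {X = R} w∈R y'∉R ∘ sym)
          (Out-off (λ { refl → proj₁ (proj₂ (X⊆ q)) (Mo-unique (Mo-sym yy') mz) }) out-f))
        contra : (∃ λ p → Mo y₁ p × p ∉ R) → (∃ λ p → Mo y₂ p × p ∉ R) → ⊥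
        contra (y₁' , m₁ , q₁) (y₂' , m₂ , q₂) = add₂⊥
          (add₂ l₁ (out-y p₁ y₁≢w) m₁ (out-y' p₁ m₁ q₁) (Cr-sym (uncov-Cr ¬ct ty₁)) (flip-In out-t))
          (Out-off (y₁≢y₂ ∘ sym) (out-y p₂ y₂≢w)) m₂
          (Out-off (∈∉-≢ {X = R} (proj₁ (X⊆ p₁)) q₂ ∘ sym) (out-y' p₂ m₂ q₂))
          (Cr-sym (uncov-Cr ¬ct ty₂)) (In-keep (out-y p₁ y₁≢w) (flip-In out-t))

    Two : (Fin n → Bool) → Fin n → Set
    Two X v = ∃ λ r → ∃ λ s → r ∈ X × s ∈ X × r ≢ s × H v r × H v s

    two? : ∀ X v → Dec (Two X v)
    two? X v = any? (λ r → any? (λ s → ∈? X r ×-dec ∈? X s ×-dec ¬? (r ≟ s) ×-dec H? v r ×-dec H? v s))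

    -- Otherwise replacing z by its partner m in R would decrease e.

    quiet : ∀ {z m w} → z ∈ R → Isolated z → Two R z → Mo z m → Adj m w → w ∈ R → w ≡ z
    quiet {z} {m} {w} z∈R iso (r , s , r∈R , s∈R , r≢s , zr , zs) zm mw w∈R with w ≟ z
    ... | yes q = q
    -- Weight at least 4 around `z` against at most 3 around `m`.
    ... | no w≢z = ⊥-elim (<⇒≱ (s≤s (deg-head z∈R zm mw w∈R w≢z sub)) (≤-trans four (exchange₁ z∈R zm)))
      where
      sub : ∀ {y} → y ∈ remove z R → y ∈ R × y ≢ z × ¬ Adj z y
      sub p = proj₂ (∈-remove R p) , proj₁ (∈-remove R p) , iso (proj₂ (∈-remove R p))
      four : 4 ≤ Deg (remove z R) z
      four = subst (_≤ Deg (remove z R) z) (cong₂ _+_ (W-two (iso r∈R) zr) (W-two (iso s∈R) zs))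
        (Deg-≥₂ (remove z R) (remove-∈ R (proj₁ zr ∘ sym) r∈R) (remove-∈ R (proj₁ zs ∘ sym) s∈R) r≢s)

    -- Of the neighbours `d`, `b` and u of `a`, the first has no neighbour in `R`, and the second
    -- has at most `d'`, which is not in `X`. So everything lies behind u. Two vertices of `X` there
    -- would allow the moves `a`, `b`, u, y₁, y₂ with changes 2 - 2 + 2 - 2 - 2.
    deg-exit : ∀ {d a d' b X} → Mo d a → Mo d' b → Adj a b → a ∉ R → b ∉ R → Isolated d →
               (∀ {w} → Adj a w → w ∈ R → w ≡ d) → (∀ {w} → Adj b w → w ∈ R → w ≡ d') →
               (∀ {y} → y ∈ X → y ∈ R × y ≢ d × y ≢ d') → Deg X a ≤ 2
    deg-exit {d} {a} {d'} {b} {X} da d'b ab a∉R b∉R iso qa qb X⊆ = Deg-unique unique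
      where
      ad = Mo-sym da
      bd' = Mo-sym d'b
      ab× = B-Cr a∉R b∉R ab
      via : ∀ {y} → y ∈ X → H a y → ∃ λ u → Adj a u × u ≢ d × u ≢ b × Adj u y
      via y∈X (_ , inj₁ ay) = ⊥-elim (proj₁ (proj₂ (X⊆ y∈X)) (qa ay (proj₁ (X⊆ y∈X))))
      via y∈X (_ , inj₂ (u , au , uy)) with u ≟ d | u ≟ b
      ... | yes refl | _ = ⊥-elim (iso (proj₁ (X⊆ y∈X)) uy)
      ... | no _ | yes refl = ⊥-elim (proj₂ (proj₂ (X⊆ y∈X)) (qb uy (proj₁ (X⊆ y∈X))))
      ... | no u≢d | no u≢b = u , au , u≢d , u≢b , uy
      unique : ∀ {y₁ y₂} → y₁ ∈ X → y₂ ∈ X → H a y₁ → H a y₂ → y₁ ≡ y₂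
      unique {y₁} {y₂} p₁ p₂ h₁ h₂ with y₁ ≟ y₂ | via p₁ h₁ | via p₂ h₂
      ... | yes q | _ | _ = q
      ... | no y₁≢y₂ | u , au , u≢d , u≢b , uy₁ | u₂ , au₂ , u₂≢d , u₂≢b , uy₂
        with refl ← nbrs (proj₁ ad) ab au au₂ (Mo-Cr ad ab×) (u≢d ∘ sym) (u≢b ∘ sym) u₂≢d u₂≢b
        = ⊥-elim (contra (partner (proj₁ (X⊆ p₁))) (partner (proj₁ (X⊆ p₂))))
        where
        au× = Cr-≢Mo ad au u≢d
        h = flip b (flip a f)
        out-R : ∀ {y} → y ∈ R → Out h y
        out-R q = Out-off (∈∉-≢ {X = R} q b∉R) (Out-off (∈∉-≢ {X = R} q a∉R) out-f)
        d'∈R : d' ∈ R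
        d'∈R = Mo-∈ b∉R bd'
        out-b : Out (flip a f) b
        out-b = Out-off (adj-≢ ab ∘ sym) out-f
        l₀ : Low h 0
        l₀ = add₂ (start ad) out-b bd' (Out-off (∈∉-≢ {X = R} d'∈R a∉R) out-f) (Cr-sym ab×) (flip-In out-f)
        out-u : Out h u
        out-u = Out-off u≢b (Out-off (adj-≢ au ∘ sym) out-f)
        in-a : In h a
        in-a = In-keep out-b (flip-In out-f)
        -- If `uy` were monochromatic, `u` with its unmoved partner `y` would itself be a gain next
        -- to `a`.
        cross : ∀ {y} → y ∈ R → Adj u y → Cr y u
        cross q uy with Mo⊎Cr uy
        ... | inj₁ m = ⊥-elim (add₂⊥ l₀ out-u m (out-R q) (Cr-sym au×) in-a)
        ... | inj₂ c = Cr-sym c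
        l₁ : Low (flip u h) 2
        l₁ = add₁ l₀ out-u (Cr-sym au×) in-a
        out-y : ∀ {y} → y ∈ X → Adj u y → Out (flip u h) y
        out-y q uy = Out-off (adj-≢ uy ∘ sym) (out-R (proj₁ (X⊆ q)))
        out-y' : ∀ {y y'} → y ∈ X → Adj u y → Mo y y' → Out (flip u h) y'
        out-y' q uy yy' = Out-off (Mo-Cr yy' (cross (proj₁ (X⊆ q)) uy))
          (Out-off (λ { refl → proj₂ (proj₂ (X⊆ q)) (Mo-unique (Mo-sym yy') bd') })
          (Out-off (λ { refl → proj₁ (proj₂ (X⊆ q)) (Mo-unique (Mo-sym yy') ad) }) out-f))
        contra : (∃ λ p → Mo y₁ p × p ∉ R) → (∃ λ p → Mo y₂ p × p ∉ R) → ⊥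
        contra (y₁' , m₁ , q₁) (y₂' , m₂ , q₂) = add₂⊥
          (add₂ l₁ (out-y p₁ uy₁) m₁ (out-y' p₁ uy₁ m₁) (cross (proj₁ (X⊆ p₁)) uy₁) (flip-In out-u))
          (Out-off (y₁≢y₂ ∘ sym) (out-y p₂ uy₂)) m₂
          (Out-off (∈∉-≢ {X = R} (proj₁ (X⊆ p₁)) q₂ ∘ sym) (out-y' p₂ uy₂ m₂))
          (cross (proj₁ (X⊆ p₂)) uy₂) (In-keep (out-y p₁ uy₁) (flip-In out-u))

    -- Trading d and d' for the adjacent pair a, b removes weight at least 8 and adds at most 5.

    twin-exits : ∀ {d a d' b} → d ∈ R → d' ∈ R → Isolated d → Isolated d' → Two R d → Two R d' →
                 Mo d a → Mo d' b → Adj a b → d ≢ d' → ¬ Common d d' → ⊥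
    twin-exits {d} {a} {d'} {b} d∈R d'∈R iso iso' two@(r , s , r∈R , s∈R , r≢s , dr , ds)
               two'@(r' , s' , r'∈R , s'∈R , r'≢s' , d'r' , d's') da d'b ab d≢d' ¬c =
      <⇒≱ (s≤s (≤-trans upper (m≤n+m 5 2))) (≤-trans lower (exchange₂ d∈R d'∈R d≢d' da d'b))
      where
      R₁ = remove d R
      R₀ = remove d' R₁
      a∉R = Mo-∉ d∈R da
      b∉R = Mo-∉ d'∈R d'b
      qa : ∀ {w} → Adj a w → w ∈ R → w ≡ d
      qa = quiet d∈R iso two da
      qb : ∀ {w} → Adj b w → w ∈ R → w ≡ d'
      qb = quiet d'∈R iso' two' d'b
      sub : ∀ {y} → y ∈ R₀ → y ∈ R × y ≢ d × y ≢ d'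
      sub p = let (y≢d' , q) = ∈-remove R₁ p ; (y≢d , q') = ∈-remove R q in q' , y≢d , y≢d'
      -- `d` is not an H-neighbour of `d'`, so removing `d` first takes no weight away from `d'`.
      ≢d : ∀ {y} → H d' y → y ∈ R → y ≢ d
      ≢d (_ , inj₁ x) y∈R refl = iso' y∈R x
      ≢d (_ , inj₂ (u , x , y)) _ refl = ¬c (u , adj-sym y , adj-sym x)
      ∈R₀ : ∀ {y} → H d' y → y ∈ R → y ∈ R₀
      ∈R₀ p q = remove-∈ R₁ (proj₁ p ∘ sym) (remove-∈ R (≢d p q) q)
      lower : 8 ≤ Deg R₁ d + Deg R₀ d'
      lower = +-mono-≤
        (subst (_≤ Deg R₁ d) (cong₂ _+_ (W-two (iso r∈R) dr) (W-two (iso s∈R) ds))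
          (Deg-≥₂ R₁ (remove-∈ R (proj₁ dr ∘ sym) r∈R) (remove-∈ R (proj₁ ds ∘ sym) s∈R) r≢s))
        (subst (_≤ Deg R₀ d') (cong₂ _+_ (W-two (iso' r'∈R) d'r') (W-two (iso' s'∈R) d's'))
          (Deg-≥₂ R₀ (∈R₀ d'r' r'∈R) (∈R₀ d's' s'∈R) r'≢s'))
      upper : Deg R₀ a + Deg (insert a R₀) b ≤ 5
      upper = +-mono-≤ (deg-exit da d'b ab a∉R b∉R iso qa qb sub)
        (≤-trans (Deg-insert R₀ a b) (+-mono-≤ (≤-reflexive (W-adj (adj-sym ab)))
          (deg-exit d'b da (adj-sym ab) b∉R a∉R iso' qb qa (λ p → let (x , y , z) = sub p in x , z , y))))

    -- Trading z and s for m and t removes weight at least 7 and adds at most 6.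

    no-double-tail : ∀ {z m s t w α} → z ∈ R → s ∈ R → Adj z s → Mo z m → Mo s t →
                     Adj m w → w ∈ R → Isolated w → H s w → Adj t α → α ∈ R → Isolated α → ⊥
    no-double-tail {z} {m} {s} {t} {w} {α} z∈R s∈R zs zm st mw w∈R isow sw tα α∈R isoα =
      <⇒≱ (s≤s upper) (≤-trans lower (exchange₂ z∈R s∈R (adj-≢ zs) zm st))
      where
      R₁ = remove z R
      R₀ = remove s R₁
      m∉R = Mo-∉ z∈R zm
      t∉R = Mo-∉ s∈R st
      mz = Mo-sym zm
      ts = Mo-sym st
      zs× = R-Cr z∈R s∈R zs
      w≢z : w ≢ z
      w≢z refl = isow s∈R zs
      w≢s : w ≢ s
      w≢s refl = isow z∈R (adj-sym zs)
      α≢z : α ≢ z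
      α≢z refl = isoα s∈R zs
      α≢s : α ≢ s
      α≢s refl = isoα z∈R (adj-sym zs)
      w' = proj₁ (partner w∈R)
      ww' = proj₁ (proj₂ (partner w∈R))
      w'∉R = proj₂ (proj₂ (partner w∈R))
      mw× = Cr-≢Mo mz mw w≢z
      tα× = Cr-≢Mo ts tα α≢s
      m≢t : m ≢ t
      m≢t refl = adj-≢ zs (Mo-unique mz ts)
      α≢w : α ≢ w
      α≢w refl = cherry (w' , ww') (Cr-sym mw×) (Cr-sym tα×) mz ts m≢t (∈∉-≢ {X = R} s∈R m∉R)
      sub : ∀ {y} → y ∈ R₀ → y ∈ R × y ≢ z × y ≢ s
      sub p = let (y≢s , q) = ∈-remove R₁ p ; (y≢z , q') = ∈-remove R q in q' , y≢z , y≢s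
      sub-z : ∀ {y} → y ∈ R₀ → y ∈ R × y ≢ z × ¬ Adj z y
      sub-z p = let (y∈R , y≢z , y≢s) = sub p in y∈R , y≢z ,
        λ zy → cherry-R (m , zm) zs× (R-Cr z∈R y∈R zy) st y∈R (y≢s ∘ sym) (∈∉-≢ {X = R} y∈R t∉R ∘ sym)
      sub-s : ∀ {y} → y ∈ R₀ → y ∈ R × y ≢ s × ¬ Adj s y
      sub-s p = let (y∈R , y≢z , y≢s) = sub p in y∈R , y≢s ,
        λ sy → cherry-R (t , st) (Cr-sym zs×) (R-Cr s∈R y∈R sy) zm y∈R (y≢z ∘ sym) (∈∉-≢ {X = R} y∈R m∉R ∘ sym)
      ¬Htm : ¬ H t m
      ¬Htm (_ , inj₁ tm) = cherry (z , mz) mw× (B-Cr m∉R t∉R (adj-sym tm)) ww' ts (∈∉-≢ {X = R} w∈R t∉R) (w≢s ∘ sym)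
      ¬Htm (_ , inj₂ (u , tu , um)) with u ≟ s | u ≟ z
      ... | yes refl | _ = cherry-R (z , mz) mw× (Cr-≢Mo mz (adj-sym um) (adj-≢ zs ∘ sym)) ww' s∈R w≢s (∈∉-≢ {X = R} s∈R w'∉R ∘ sym)
      ... | no _ | yes refl = cherry-R (s , ts) (Cr-≢Mo ts tu (adj-≢ zs)) tα× zm α∈R (α≢z ∘ sym) (∈∉-≢ {X = R} α∈R m∉R ∘ sym)
      -- Parity: both `tu` and `um` cross, so `t` and `m`, and with them `s` and `z`, are on the
      -- same side; but `zs` crosses.
      ... | no u≢s | no u≢z = proj₂ zs× (trans (proj₂ zm) (trans
              (sym (Cr-Cr (Cr-≢Mo ts tu u≢s) (Cr-sym (Cr-≢Mo mz (adj-sym um) u≢z)))) (sym (proj₂ st))))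
      -- At `z`, weight 1 for `s` and 2 for `w`; at `s`, weight 2 each for `w` and `α`.
      lower : 7 ≤ Deg R₁ z + Deg R₀ s
      lower = +-mono-≤
        (subst (_≤ Deg R₁ z) (cong₂ _+_ (W-adj zs) (W-two (λ a → isow z∈R (adj-sym a)) (w≢z ∘ sym , inj₂ (m , proj₁ zm , mw))))
          (Deg-≥₂ R₁ (remove-∈ R (adj-≢ zs ∘ sym) s∈R) (remove-∈ R w≢z w∈R) (w≢s ∘ sym)))
        (subst (_≤ Deg R₀ s) (cong₂ _+_ (W-two (λ a → isow s∈R (adj-sym a)) sw) (W-two (λ a → isoα s∈R (adj-sym a)) (α≢s ∘ sym , inj₂ (t , proj₁ st , tα))))
          (Deg-≥₂ R₀ (remove-∈ R₁ w≢s (remove-∈ R w≢z w∈R)) (remove-∈ R₁ α≢s (remove-∈ R α≢z α∈R)) (α≢w ∘ sym)))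
      upper : Deg R₀ m + Deg (insert m R₀) t ≤ 6
      upper = +-mono-≤ (deg-head z∈R zm mw w∈R w≢z sub-z)
        (≤-trans (Deg-insert R₀ m t) (+-mono-≤ (≤-reflexive (W-¬H ¬Htm)) (deg-head s∈R st tα α∈R α≢s sub-s)))

    -- Trails

    outs : (Fin n → Bool) → Fin n → Bool
    outs h s = does (h s Boolₚ.≟ f s)

    Out-∈ : ∀ {h s} → Out h s → s ∈ outs h
    Out-∈ {h} {s} (unmoved p) with h s Boolₚ.≟ f s
    ... | yes _ = refl
    ... | no ¬p = ⊥-elim (¬p p)

    -- The termination measure of trails: each move uses up an unmoved vertex.
    card-flip : ∀ {h x} → Out h x → card (outs h) ≡ suc (card (outs (flip x h)))
    card-flip {h} {x} o = trans (card-remove x (outs h) (Out-∈ o)) (cong suc (card-cong pt))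
      where
      pt : remove x (outs h) ≗ outs (flip x h)
      pt y with y ≟ x
      ... | no y≢x = trans (updateAt-minimal y x (outs h) y≢x) (cong (λ b → does (b Boolₚ.≟ f y)) (sym (flip-off h y≢x)))
      ... | yes refl with outs (flip x h) x in eq
      ...   | false = updateAt-updates x (outs h)
      ...   | true = ⊥-elim (In-Out (flip-In o) (∈-Out eq) refl)
        where
        ∈-Out : ∀ {k s} → s ∈ outs k → Out k s
        ∈-Out {k} {s} p with k s Boolₚ.≟ f s | p
        ... | yes q | _ = unmoved q
        ... | no _ | ()

    -- The witness `r` guarantees that a trail entering a hub can leave it towards another vertex of
    -- `Y`.
    Step : (Fin n → Bool) → Fin n → Fin n → Set
    Step Y v c = (c ∈ Y × Cr v c) ⊎ (¬ Cov c × Adj v c × ∃ λ r → r ∈ Y × r ≢ v × Adj c r)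

    Step-Cr : ∀ {Y v c} → Step Y v c → Cr v c
    Step-Cr (inj₁ (_ , c)) = c
    Step-Cr (inj₂ (¬c , a , _)) = Cr-sym (uncov-Cr ¬c (adj-sym a))

    -- The forbidden vertex `u` will be the one just left, so that a trail never turns back.
    Next : (Fin n → Bool) → Set
    Next Y = ∀ {v} u → v ∈ Y → ∃ λ c → c ≢ u × Step Y v c

    -- Adding a hub and the next vertex of R keeps M unchanged, so a trail can only stop by closing up,
    -- which lowers M.

    Trail : (Fin n → Bool) → (Fin n → Bool) → Fin n → Set
    Trail Y h c = ∃ λ h' → 2 + M h' ≤ M h × (∀ {s} → In h s → In h' s) × In h' c ×
                 (∀ {s} → In h' s → In h s ⊎ s ∈ Y ⊎ ¬ Cov s)

    -- Induction on the number of unmoved vertices. The trail closes when `c` is in `Y`, when the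
    -- other end of the hub is moved already, or when the next step leads to a moved vertex. The
    -- partners of `Y` stay unmoved throughout: they are outside `R` because `Y` is inside, and they
    -- are not hubs because they are covered.
    trail : ∀ {Y} → (∀ {y} → y ∈ Y → y ∈ R) → Next Y → ∀ k {h v c} → card (outs h) ≤ k → In h v → Out h c → Step Y v c →
           (∀ {x p} → x ∈ Y → Mo x p → Out h p) → Trail Y h c
    trail Y⊆R next zero le _ o _ _ = ⊥-elim (<⇒≱ (s≤s z≤n) (≤-trans (≤-reflexive (sym (card-flip o))) le))
    trail Y⊆R next (suc k) {h} {v} {c} le i o (inj₁ (c∈Y , vc)) po with partner (Y⊆R c∈Y)
    ... | c' , cc' , _ = flip c h , drop₂ o cc' (po c∈Y cc') (Cr-sym vc) i , In-keep o , flip-In o ,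
                         λ j → [ (λ { refl → inj₂ (inj₁ c∈Y) }) , inj₁ ]′ (In-flip j)
    trail {Y} Y⊆R next (suc k) {h} {v} {c} le i o (inj₂ (¬c , vc , r , r∈Y , r≢v , cr)) po with in? h r
    ... | inj₁ j = flip c h , drop-two o (uncov-Cr ¬c (adj-sym vc)) i (uncov-Cr ¬c cr) j (r≢v ∘ sym) , In-keep o , flip-In o ,
                   λ j → [ (λ { refl → inj₂ (inj₂ ¬c) }) , inj₁ ]′ (In-flip j)
    ... | inj₂ o-r with next c r∈Y | partner (Y⊆R r∈Y)
    ...   | c₂ , c₂≢c , st | r' , rr' , r'∉R = go (in? h₂ c₂)
      where
      h₁ = flip c h
      h₂ = flip r h₁
      r≢c = adj-≢ cr ∘ sym
      r-out : Out h₁ r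
      r-out = Out-off r≢c o-r
      r'-out : Out h₁ r'
      r'-out = Out-off (λ { refl → ¬c (r , Mo-sym rr') }) (po r∈Y rr')
      rc× = Cr-sym (uncov-Cr ¬c cr)
      c-in : In h₁ c
      c-in = flip-In o
      up : M h₁ ≤ 2 + M h
      up = rise o (uncov-Cr ¬c (adj-sym vc)) i
      keep : ∀ {s} → In h s → In h₂ s
      keep = In-keep r-out ∘ In-keep o
      back : ∀ {s} → In h₂ s → In h s ⊎ s ∈ Y ⊎ ¬ Cov s
      back j with In-flip j
      ... | inj₁ refl = inj₂ (inj₁ r∈Y)
      ... | inj₂ j' with In-flip j'
      ...   | inj₁ refl = inj₂ (inj₂ ¬c)
      ...   | inj₂ j'' = inj₁ j''
      go : In h₂ c₂ ⊎ Out h₂ c₂ → Trail Y h c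
      -- Now `r` has three monochromatic edges, to its partner, to `c` and to `c₂`; the drop of 6
      -- outweighs the cost 2 of the hub.
      go (inj₁ j) = h₂ , +-cancelˡ-≤ 2 _ _ (≤-trans (m≤n+m _ 2) (≤-trans (drop₃ r-out rr' r'-out rc× c-in (Step-Cr st) c₂-in (c₂≢c ∘ sym)) up))
                    , keep , In-keep r-out c-in , back
        where
        c₂-in : In h₁ c₂
        c₂-in with In-flip j
        ... | inj₁ refl = ⊥-elim (adj-≢ (proj₁ (Step-Cr st)) refl)
        ... | inj₂ j' = j'
      go (inj₂ o₂) with trail Y⊆R next k {h₂} {r} {c₂} fewer (flip-In r-out) o₂ st po₂
        where
        fewer : card (outs h₂) ≤ k
        fewer = ≤-trans (m≤n+m _ 1) (≤-trans (≤-reflexive (sym (card-flip r-out))) (+-cancelˡ-≤ 1 _ _ (≤-trans (≤-reflexive (sym (card-flip o))) le)))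
        po₂ : ∀ {x p} → x ∈ Y → Mo x p → Out h₂ p
        po₂ q m = Out-off (∈∉-≢ {X = R} (Y⊆R r∈Y) (Mo-∉ (Y⊆R q) m) ∘ sym) (Out-off (λ { refl → ¬c (_ , Mo-sym m) }) (po q m))
      ... | h' , l , k' , _ , b' = h' , ≤-trans l (+-cancelˡ-≤ 2 _ _ (≤-trans (drop₂ r-out rr' r'-out rc× c-in) up)) ,
                                   k' ∘ keep , k' (In-keep r-out c-in) , λ j → [ back , inj₂ ]′ (b' j)

    -- Tokens

    private
      hub-uncov : ∀ {u p x y} → Mo u p → x ∈ R → y ∈ R → Adj u x → Adj u y → x ≢ y → x ≢ p → y ≢ p → ⊥
      hub-uncov {p = p} up x∈R y∈R ux uy x≢y x≢p y≢p with partner x∈R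
      ... | x' , xx' , x'∉R = cherry-R (p , up) (Cr-≢Mo up ux x≢p) (Cr-≢Mo up uy y≢p) xx' y∈R x≢y (∈∉-≢ {X = R} y∈R x'∉R ∘ sym)

      -- At most one leaf is the partner of the centre, and the other two would form a cherry at it.
      star-uncov : ∀ {u a b c} → Star R u a b c → ¬ Cov u
      star-uncov {u} {a} {b} {c} s (p , up) with a ≟ p | b ≟ p
      ... | no a≢p | no b≢p = hub-uncov up a∈R b∈R ua ub a≢b a≢p b≢p
        where open Star s
      ... | yes refl | _ = hub-uncov up b∈R c∈R ub uc b≢c (a≢b ∘ sym) (a≢c ∘ sym)
        where open Star s
      ... | no _ | yes refl = hub-uncov up a∈R c∈R ua uc a≢c a≢b (b≢c ∘ sym)
        where open Star s

    module StarSet {u d a b} (s : Star R u d a b) where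
      open Star s renaming (a∈R to d∈R; b∈R to a∈R; c∈R to b∈R; ua to ud; ub to ua; uc to ub; a≢b to d≢a; a≢c to d≢b; b≢c to a≢b)

      ¬cov : ¬ Cov u
      ¬cov = star-uncov s

      u∉R : u ∉ R
      u∉R = uncov-∉ ¬cov

      private
        cr : ∀ {x} → Adj u x → Cr x u
        cr = Cr-sym ∘ uncov-Cr ¬cov
        ≢u : ∀ {x} → x ∈ R → x ≢ u
        ≢u q = ∈∉-≢ {X = R} q u∉R
        p≢u : ∀ {x p} → Mo x p → p ≢ u
        p≢u m refl = ¬cov (_ , Mo-sym m)
        h₁ = flip d f
        h₂ = flip u h₁
        h₃ = flip a h₂
        o-u : Out h₁ u
        o-u = Out-off (≢u d∈R ∘ sym) out-f
        o-a : Out h₂ a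
        o-a = Out-off (≢u a∈R) (Out-off (d≢a ∘ sym) out-f)
        o-b : Out h₃ b
        o-b = Out-off (a≢b ∘ sym) (Out-off (≢u b∈R) (Out-off (d≢b ∘ sym) out-f))

      set : Fin n → Bool
      set = flip b h₃

      in-d : In set d
      in-d = In-keep o-b (In-keep o-a (In-keep o-u (flip-In out-f)))

      in-u : In set u
      in-u = In-keep o-b (In-keep o-a (flip-In o-u))

      in-a : In set a
      in-a = In-keep o-b (flip-In o-a)

      in-b : In set b
      in-b = flip-In o-b

      elements : ∀ {x} → In set x → x ≡ d ⊎ x ≡ a ⊎ x ≡ b ⊎ x ≡ u
      elements i with In-flip i
      ... | inj₁ p = inj₂ (inj₂ (inj₁ p))
      ... | inj₂ i₃ with In-flip i₃
      ... | inj₁ p = inj₂ (inj₁ p)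
      ... | inj₂ i₂ with In-flip i₂
      ... | inj₁ p = inj₂ (inj₂ (inj₂ p))
      ... | inj₂ i₁ with In-flip i₁
      ... | inj₁ p = inj₁ p
      ... | inj₂ i₀ = ⊥-elim (In-Out i₀ out-f refl)

      out : ∀ {x} → x ≢ d → x ≢ a → x ≢ b → x ≢ u → Out set x
      out x≢d x≢a x≢b x≢u = Out-off x≢b (Out-off x≢a (Out-off x≢u (Out-off x≢d out-f)))

      out-∉ : ∀ {x} → x ∉ R → x ≢ u → Out set x
      out-∉ q = out (∈∉-≢ {X = R} d∈R q ∘ sym) (∈∉-≢ {X = R} a∈R q ∘ sym) (∈∉-≢ {X = R} b∈R q ∘ sym)

      -- The moves `d`, `u`, `a`, `b` change `M` by at most 2 + 2 - 2 - 2.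
      isLow : Low set 0
      isLow with partner d∈R | partner a∈R | partner b∈R
      ... | d' , dd' , _ | a' , aa' , a'∉R | b' , bb' , b'∉R =
        add₂ (add₂ (add₁ (start dd') o-u (uncov-Cr ¬cov ud) (flip-In out-f))
          o-a aa' (Out-off (p≢u aa') (Out-off (∈∉-≢ {X = R} d∈R a'∉R ∘ sym) out-f)) (cr ua) (flip-In o-u))
          o-b bb' (Out-off (∈∉-≢ {X = R} a∈R b'∉R ∘ sym) (Out-off (p≢u bb') (Out-off (∈∉-≢ {X = R} d∈R b'∉R ∘ sym) out-f)))
          (cr ub) (In-keep o-a (flip-In o-u))

      -- A neighbour of `d` in `R` would be a further gain. It is not another leaf, since the leaves
      -- are on one side and edges within `R` cross.
      star-isolated : Isolated d
      star-isolated {r} r∈R dr with partner r∈R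
      ... | r' , rr' , r'∉R = add₂⊥ isLow (out (adj-≢ dr ∘ sym) (apart ua) (apart ub) (≢u r∈R)) rr' (out-∉ r'∉R (p≢u rr'))
              (R-Cr r∈R d∈R (adj-sym dr)) in-d
        where
        apart : ∀ {x} → Adj u x → r ≢ x
        apart ux refl = proj₂ (R-Cr d∈R r∈R dr) (Cr-Cr (cr ud) (uncov-Cr ¬cov ux))

    star-isolated₁ : ∀ {u a b c} → Star R u a b c → Isolated b
    star-isolated₁ s = StarSet.star-isolated (Star-rot s)

    star-isolated₂ : ∀ {u a b c} → Star R u a b c → Isolated c
    star-isolated₂ s = StarSet.star-isolated (Star-rot (Star-rot s))

    -- Stuck sets and the choice of a token.

    NoStar HubOnly : (Fin n → Bool) → Set
    NoStar X = ∀ {u a b c} → a ∈ X → b ∈ X → c ∈ X → Adj u a → Adj u b → Adj u c → a ≢ b → a ≢ c → b ≢ c → ⊥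
    HubOnly X = ∀ {v r} → v ∈ X → r ∈ X → H v r → ∃ λ c → ¬ Cov c × Adj v c × Adj c r

    record Stuck (X : Fin n → Bool) : Set where
      field
        ⊆R : ∀ {v} → v ∈ X → v ∈ R
        two : ∀ {v} → v ∈ X → Two X v

      twoR : ∀ {v} → v ∈ X → Two R v
      twoR q = let (r , s , r∈X , s∈X , rest) = two q in r , s , ⊆R r∈X , ⊆R s∈X , rest

    -- In `star` the other leaves are kept as members of `X`, so that they have two H-neighbours and
    -- differ from every token outside `X`. In `head` the last condition makes `d` isolated.
    data Token (X : Fin n → Bool) (d : Fin n) : Set where
      star : ∀ u a b → a ∈ X → b ∈ X → Star R u d a b → Token X d
      head : ∀ z m → z ∈ X → Mo z m → Adj m d → d ≢ z → ¬ Adj d z → Token X d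
      ring : NoStar X → HubOnly X → Token X d

    module _ {X : Fin n → Bool} (stuck : Stuck X) where
      open Stuck stuck

      -- If both H-neighbours were reached through one hub, they would form a star with `v`.
      hubs : NoStar X → HubOnly X → ∀ {v} → v ∈ X → ∃ λ c₁ → ∃ λ c₂ → ∃ λ r₁ → ∃ λ r₂ →
             c₁ ≢ c₂ × (¬ Cov c₁ × Adj v c₁ × Adj c₁ r₁) × (¬ Cov c₂ × Adj v c₂ × Adj c₂ r₂) ×
             (r₁ ∈ X × r₁ ≢ v) × (r₂ ∈ X × r₂ ≢ v) × r₁ ≢ r₂
      hubs noStar hubOnly {v} v∈X with two v∈X
      ... | r₁ , r₂ , r₁∈X , r₂∈X , r₁≢r₂ , vr₁ , vr₂ with hubOnly v∈X r₁∈X vr₁ | hubOnly v∈X r₂∈X vr₂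
      ... | c₁ , q₁ | c₂ , q₂ = c₁ , c₂ , r₁ , r₂ , distinct , q₁ , q₂ , (r₁∈X , proj₁ vr₁ ∘ sym) , (r₂∈X , proj₁ vr₂ ∘ sym) , r₁≢r₂
        where
        distinct : c₁ ≢ c₂
        distinct refl = noStar v∈X r₁∈X r₂∈X (adj-sym (proj₁ (proj₂ q₁))) (proj₂ (proj₂ q₁)) (proj₂ (proj₂ q₂)) (proj₁ vr₁) (proj₁ vr₂) r₁≢r₂

      hub-next : NoStar X → HubOnly X → Next X
      hub-next noStar hubOnly u v∈X with hubs noStar hubOnly v∈X
      ... | c₁ , c₂ , r₁ , r₂ , c₁≢c₂ , (¬c₁ , vc₁ , c₁r₁) , (¬c₂ , vc₂ , c₂r₂) , (r₁∈X , r₁≢v) , (r₂∈X , r₂≢v) , _ with c₁ ≟ u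
      ... | no c₁≢u = c₁ , c₁≢u , inj₂ (¬c₁ , vc₁ , r₁ , r₁∈X , r₁≢v , c₁r₁)
      ... | yes refl = c₂ , c₁≢c₂ ∘ sym , inj₂ (¬c₂ , vc₂ , r₂ , r₂∈X , r₂≢v , c₂r₂)

      -- The partner and two hubs exhaust the neighbours of `v`, and none of them is in `R`.
      ring-isolated : NoStar X → HubOnly X → ∀ {v} → v ∈ X → Isolated v
      ring-isolated noStar hubOnly {v} v∈X {r} r∈R vr with hubs noStar hubOnly v∈X | partner (⊆R v∈X)
      ... | c₁ , c₂ , _ , _ , c₁≢c₂ , (¬c₁ , vc₁ , _) , (¬c₂ , vc₂ , _) , _ | v' , vv' , v'∉R =
        ∈∉ {X = R} (subst (_∈ R) (nbrs (proj₁ vv') vc₁ vc₂ vr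
            (λ { refl → ¬c₁ (_ , Mo-sym vv') }) (λ { refl → ¬c₂ (_ , Mo-sym vv') }) c₁≢c₂
            (∈∉-≢ {X = R} r∈R v'∉R) (∈∉-≢ {X = R} r∈R (uncov-∉ ¬c₁))) r∈R) (uncov-∉ ¬c₂)

      isolated : ∀ {d} → d ∈ X → Token X d → Isolated d
      isolated d∈X (star u a b _ _ s) = StarSet.star-isolated s
      isolated {d} d∈X (head z m z∈X zm md d≢z ¬dz) {r} r∈R dr with partner (⊆R d∈X)
      -- A neighbour `r` in `R` forms a cherry at `d` together with `m`; `¬dz` says that `r` is not
      -- the partner of `m`.
      ... | d' , dd' , _ = cherry-R (d' , dd') (Cr-sym (Cr-≢Mo mz md d≢z)) (R-Cr (⊆R d∈X) r∈R dr) mz r∈R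
              (∈∉-≢ {X = R} r∈R (Mo-∉ (⊆R z∈X) zm) ∘ sym) (λ { refl → ¬dz dr })
        where mz = Mo-sym zm
      isolated d∈X (ring noStar hubOnly) = ring-isolated noStar hubOnly d∈X

      private
        Starred : Set
        Starred = ∃ λ u → ∃ λ d → ∃ λ a → ∃ λ b → (d ∈ X × a ∈ X × b ∈ X) × (Adj u d × Adj u a × Adj u b) × (d ≢ a × d ≢ b × a ≢ b)

        starred? : Dec Starred
        starred? = any? (λ u → any? (λ d → any? (λ a → any? (λ b →
          (∈? X d ×-dec ∈? X a ×-dec ∈? X b) ×-dec (adj? u d ×-dec adj? u a ×-dec adj? u b) ×-dec
          (¬? (d ≟ a) ×-dec ¬? (d ≟ b) ×-dec ¬? (a ≟ b))))))

        Headed : Set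
        Headed = ∃ λ d → ∃ λ z → ∃ λ m → d ∈ X × z ∈ X × (Adj z m × f z ≡ f m) × Adj m d × d ≢ z × ¬ Adj d z

        headed? : Dec Headed
        headed? = any? (λ d → any? (λ z → any? (λ m →
          ∈? X d ×-dec ∈? X z ×-dec mono? f z m ×-dec adj? m d ×-dec ¬? (d ≟ z) ×-dec ¬? (adj? d z))))

      module Plain (noStar : NoStar X) (¬headed : ¬ Headed) where

        -- A covered common neighbour joined to `v` or `r` by a monochromatic edge would make the
        -- other one a head. If both edges cross, `v` and `r` form a cherry at it.
        link : ∀ {v r} → v ∈ X → r ∈ X → H v r → Adj v r ⊎ ∃ λ c → ¬ Cov c × Adj v c × Adj c r
        link _ _ (_ , inj₁ vr) = inj₁ vr
        link {v} {r} v∈X r∈X (v≢r , inj₂ (u , vu , ur)) with adj? v r | cov? u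
        ... | yes vr | _ = inj₁ vr
        ... | no _ | no ¬c = inj₂ (u , ¬c , vu , ur)
        ... | no ¬vr | yes (p , up) with Mo⊎Cr vu | Mo⊎Cr ur | partner (⊆R v∈X)
        ...   | inj₁ vu= | _ | _ = ⊥-elim (¬headed (r , v , u , r∈X , v∈X , vu= , ur , v≢r ∘ sym , ¬vr ∘ adj-sym))
        ...   | _ | inj₁ ur= | _ = ⊥-elim (¬headed (v , r , u , v∈X , r∈X , Mo-sym ur= , adj-sym vu , v≢r , ¬vr))
        ...   | inj₂ vu× | inj₂ ur× | v' , vv' , v'∉R =
                ⊥-elim (cherry-R (p , up) (Cr-sym vu×) ur× vv' (⊆R r∈X) v≢r (∈∉-≢ {X = R} (⊆R r∈X) v'∉R ∘ sym))

        plain-next : Next X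
        plain-next {v} u v∈X with two v∈X
        ... | r₁ , r₂ , r₁∈X , r₂∈X , r₁≢r₂ , vr₁ , vr₂ with link v∈X r₁∈X vr₁ | link v∈X r₂∈X vr₂
        ... | inj₁ a₁ | inj₁ a₂ = pick r₁≢r₂ (inj₁ (r₁∈X , R-Cr (⊆R v∈X) (⊆R r₁∈X) a₁)) (inj₁ (r₂∈X , R-Cr (⊆R v∈X) (⊆R r₂∈X) a₂))
          where
          pick : ∀ {c₁ c₂} → c₁ ≢ c₂ → Step X v c₁ → Step X v c₂ → ∃ λ c → c ≢ u × Step X v c
          pick {c₁} {c₂} c₁≢c₂ s₁ s₂ with c₁ ≟ u
          ... | no p = c₁ , p , s₁
          ... | yes refl = c₂ , c₁≢c₂ ∘ sym , s₂
        ... | inj₁ a₁ | inj₂ (c₂ , ¬c , vc , cr) with r₁ ≟ u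
        ...   | no p = r₁ , p , inj₁ (r₁∈X , R-Cr (⊆R v∈X) (⊆R r₁∈X) a₁)
        ...   | yes refl = c₂ , ∈∉-≢ {X = R} (⊆R r₁∈X) (uncov-∉ ¬c) ∘ sym , inj₂ (¬c , vc , r₂ , r₂∈X , proj₁ vr₂ ∘ sym , cr)
        plain-next {v} u v∈X | r₁ , r₂ , r₁∈X , r₂∈X , r₁≢r₂ , vr₁ , vr₂ | inj₂ (c₁ , ¬c , vc , cr) | inj₁ a₂ with r₂ ≟ u
        ...   | no p = r₂ , p , inj₁ (r₂∈X , R-Cr (⊆R v∈X) (⊆R r₂∈X) a₂)
        ...   | yes refl = c₁ , ∈∉-≢ {X = R} (⊆R r₂∈X) (uncov-∉ ¬c) ∘ sym , inj₂ (¬c , vc , r₁ , r₁∈X , proj₁ vr₁ ∘ sym , cr)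
        plain-next {v} u v∈X | r₁ , r₂ , r₁∈X , r₂∈X , r₁≢r₂ , vr₁ , vr₂ | inj₂ (c₁ , ¬c₁ , vc₁ , cr₁) | inj₂ (c₂ , ¬c₂ , vc₂ , cr₂) with c₁ ≟ u
        ...   | no p = c₁ , p , inj₂ (¬c₁ , vc₁ , r₁ , r₁∈X , proj₁ vr₁ ∘ sym , cr₁)
        ...   | yes refl = c₂ , (λ { refl → noStar v∈X r₁∈X r₂∈X (adj-sym vc₁) cr₁ cr₂ (proj₁ vr₁) (proj₁ vr₂) r₁≢r₂ }) ,
                           inj₂ (¬c₂ , vc₂ , r₂ , r₂∈X , proj₁ vr₂ ∘ sym , cr₂)

        -- Moving `y` and then `v` breaks even, and a trail that leaves `v` away from `y` gains 2.
        no-edge : ∀ {v y} → v ∈ X → y ∈ X → ¬ Adj v y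
        no-edge {v} {y} v∈X y∈X vy with plain-next y v∈X | partner (⊆R v∈X) | partner (⊆R y∈X)
        ... | c , c≢y , st | v' , vv' , v'∉R | y' , yy' , _ = none h' (≤-trans l (Low.bound isLow))
          where
          h = flip v (flip y f)
          o-v : Out (flip y f) v
          o-v = Out-off (adj-≢ vy) out-f
          out-p : ∀ {p} → p ∉ R → Out h p
          out-p q = Out-off (∈∉-≢ {X = R} (⊆R v∈X) q ∘ sym) (Out-off (∈∉-≢ {X = R} (⊆R y∈X) q ∘ sym) out-f)
          isLow : Low h 0
          isLow = add₂ (start yy') o-v vv' (Out-off (∈∉-≢ {X = R} (⊆R y∈X) v'∉R ∘ sym) out-f) (R-Cr (⊆R v∈X) (⊆R y∈X) vy) (flip-In out-f)
          t = trail ⊆R plain-next (card (outs h)) ≤-refl (flip-In o-v) (Out-off (adj-≢ (proj₁ (Step-Cr st)) ∘ sym) (Out-off c≢y out-f)) st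
                (λ q m → out-p (Mo-∉ (⊆R q) m))
          h' = proj₁ t
          l = proj₁ (proj₂ t)

        hub-only : HubOnly X
        hub-only v∈X r∈X vr with link v∈X r∈X vr
        ... | inj₁ a = ⊥-elim (no-edge v∈X r∈X a)
        ... | inj₂ q = q

      token : ∀ {x} → x ∈ X → ∃ λ d → d ∈ X × Token X d
      token {x} x∈X with starred? | headed?
      ... | yes (u , d , a , b , (d∈X , a∈X , b∈X) , (ud , ua , ub) , (d≢a , d≢b , a≢b)) | _ =
        d , d∈X , star u a b a∈X b∈X (record { a∈R = ⊆R d∈X ; b∈R = ⊆R a∈X ; c∈R = ⊆R b∈X ; ua = ud ; ub = ua ; uc = ub
                                              ; a≢b = d≢a ; a≢c = d≢b ; b≢c = a≢b })
      ... | no _ | yes (d , z , m , d∈X , z∈X , zm , md , d≢z , ¬dz) = d , d∈X , head z m z∈X zm md d≢z ¬dz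
      ... | no ¬starred | no ¬headed = x , x∈X , ring noStar (Plain.hub-only noStar ¬headed)
        where
        noStar : NoStar X
        noStar {u} {a} {b} {c} a∈X b∈X c∈X ua ub uc a≢b a≢c b≢c =
          ¬starred (u , a , b , c , (a∈X , b∈X , c∈X) , (ua , ub , uc) , (a≢b , a≢c , b≢c))

    -- Clean sets with excess 0 can be extended along a path of G towards another token.

    record Clean (h : Fin n → Bool) : Set where
      field
        -- Both fields secure the unmoved partner required by `add₂`: the first for a vertex next to
        -- an unmoved token, the second for the token itself.
        tame : ∀ {s p α} → In h s → s ∈ R → Mo s p → Adj p α → α ∈ R → Isolated α → α ≡ s
        cover : ∀ {s p} → In h s → p ∈ R → Mo p s → Isolated p → ⊥

      partner-out : ∀ {s p} → p ∈ R → Isolated p → Mo p s → Out h s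
      partner-out {s} p∈R iso m with in? h s
      ... | inj₁ i = ⊥-elim (cover i p∈R m iso)
      ... | inj₂ o = o

    -- A break-even set for the token `d` that already contains the vertex `c` through which a path
    -- from `d` to the token `o` begins.
    Inner : Fin n → Fin n → Fin n → Set
    Inner d c o = ∃ λ h → Low h 0 × Clean h × In h d × In h c × Out h o

    star-clean : ∀ {X u d a b} → Stuck X → d ∈ X → a ∈ X → b ∈ X → (s : Star R u d a b) → Clean (StarSet.set s)
    star-clean {X} {u} {d} {a} {b} stuck d∈X a∈X b∈X s = record { tame = tm ; cover = cv }
      where
      open Stuck stuck
      open StarSet s
      tm : ∀ {x p α} → In set x → x ∈ R → Mo x p → Adj p α → α ∈ R → Isolated α → α ≡ x
      tm i x∈R xp pα α∈R _ with elements i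
      ... | inj₁ refl = quiet x∈R star-isolated (twoR d∈X) xp pα α∈R
      ... | inj₂ (inj₁ refl) = quiet x∈R (star-isolated₁ s) (twoR a∈X) xp pα α∈R
      ... | inj₂ (inj₂ (inj₁ refl)) = quiet x∈R (star-isolated₂ s) (twoR b∈X) xp pα α∈R
      ... | inj₂ (inj₂ (inj₂ refl)) = ⊥-elim (∈∉ {X = R} x∈R u∉R)
      cv : ∀ {x p} → In set x → p ∈ R → Mo p x → Isolated p → ⊥
      cv i p∈R px _ with elements i
      ... | inj₁ refl = ∈∉ {X = R} (⊆R d∈X) (Mo-∉ p∈R px)
      ... | inj₂ (inj₁ refl) = ∈∉ {X = R} (⊆R a∈X) (Mo-∉ p∈R px)
      ... | inj₂ (inj₂ (inj₁ refl)) = ∈∉ {X = R} (⊆R b∈X) (Mo-∉ p∈R px)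
      ... | inj₂ (inj₂ (inj₂ refl)) = ¬cov (_ , Mo-sym px)

    module Head {X d z m} (stuck : Stuck X) (d∈X : d ∈ X) (z∈X : z ∈ X) (zm : Mo z m) (md : Adj m d) (d≢z : d ≢ z) (¬dz : ¬ Adj d z) where
      open Stuck stuck

      private
        d∈R = ⊆R d∈X
        z∈R = ⊆R z∈X
        mz = Mo-sym zm
        m∉R = Mo-∉ z∈R zm
        md× = Cr-≢Mo mz md d≢z
        d' = proj₁ (partner d∈R)
        dd' = proj₁ (proj₂ (partner d∈R))
        d'∉R = proj₂ (proj₂ (partner d∈R))
        iso = isolated stuck d∈X (head z m z∈X zm md d≢z ¬dz)
        h₁ = flip m f
        h₂ = flip d h₁

        -- Otherwise `quiet` would forbid the second neighbour `d` of `m` in `R`. This lets `m`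
        -- belong to a clean set.
        z-busy : ¬ Isolated z
        z-busy iso-z = d≢z (quiet z∈R iso-z (twoR z∈X) zm md d∈R)

        o-d : Out h₁ d
        o-d = Out-off (adj-≢ md ∘ sym) out-f

        low₂ : Low h₂ 0
        low₂ = add₂ (start mz) o-d dd' (Out-off (Mo-Cr dd' (Cr-sym md×)) out-f) (Cr-sym md×) (flip-In out-f)

        elements₂ : ∀ {x} → In h₂ x → x ≡ d ⊎ x ≡ m
        elements₂ i with In-flip i
        ... | inj₁ p = inj₁ p
        ... | inj₂ i₁ with In-flip i₁
        ... | inj₁ p = inj₂ p
        ... | inj₂ i₀ = ⊥-elim (In-Out i₀ out-f refl)

      inner-m : ∀ {o} → o ∈ R → o ≢ d → Inner d m o
      inner-m o∈R o≢d = h₂ , low₂ , record { tame = tm ; cover = cv } , flip-In o-d , In-keep o-d (flip-In out-f) ,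
                       Out-off o≢d (Out-off (∈∉-≢ {X = R} o∈R m∉R) out-f)
        where
        tm : ∀ {x p α} → In h₂ x → x ∈ R → Mo x p → Adj p α → α ∈ R → Isolated α → α ≡ x
        tm i x∈R xp pα α∈R _ with elements₂ i
        ... | inj₁ refl = quiet x∈R iso (twoR d∈X) xp pα α∈R
        ... | inj₂ refl = ⊥-elim (∈∉ {X = R} x∈R m∉R)
        cv : ∀ {x p} → In h₂ x → p ∈ R → Mo p x → Isolated p → ⊥
        cv i p∈R px iso-p with elements₂ i
        ... | inj₁ refl = ∈∉ {X = R} d∈R (Mo-∉ p∈R px)
        ... | inj₂ refl with refl ← Mo-unique (Mo-sym px) mz = z-busy iso-p

      -- `d` has an H-neighbour besides `z`. It is not adjacent to `d`, which is isolated; it is not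
      -- behind the partner by `quiet`, nor behind `m` by `cherry`. So it lies behind the remaining
      -- neighbour `c`, which is uncovered by `cherry` again.
      second : ∀ {c} → Cr d c → c ≢ m → ∃ λ s → s ∈ X × s ≢ z × H d s × ¬ Cov c × Adj c s
      second {c} dc c≢m with other (two d∈X)
        where
        other : Two X d → ∃ λ s → s ∈ X × s ≢ z × H d s
        other (r , s , r∈X , s∈X , r≢s , dr , ds) with r ≟ z
        ... | no r≢z = r , r∈X , r≢z , dr
        ... | yes refl = s , s∈X , r≢s ∘ sym , ds
      ... | s , s∈X , s≢z , (_ , inj₁ ds) = ⊥-elim (iso (⊆R s∈X) ds)
      ... | s , s∈X , s≢z , (d≢s , inj₂ (u , du , us)) = s , s∈X , s≢z , (d≢s , inj₂ (u , du , us)) ,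
              subst (λ v → ¬ Cov v) u≡c ¬cu , subst (λ v → Adj v s) u≡c us
        where
        u≢d' : u ≢ d'
        u≢d' refl = d≢s (sym (quiet d∈R iso (twoR d∈X) dd' us (⊆R s∈X)))
        u≢m : u ≢ m
        u≢m refl = cherry-R (z , mz) md× (Cr-≢Mo mz us s≢z) dd' (⊆R s∈X) d≢s (∈∉-≢ {X = R} (⊆R s∈X) d'∉R ∘ sym)
        du× = Cr-≢Mo dd' du u≢d'
        ¬cu : ¬ Cov u
        ¬cu (p , up) = cherry (d' , dd') (Cr-sym md×) du× mz up (u≢m ∘ sym)
          (λ { refl → ∈∉ {X = R} (Mo-∈ u∉R up) m∉R })
          where
          u∉R : u ∉ R
          u∉R with R u in eq
          ... | false = refl
          ... | true = ⊥-elim (iso eq du)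
        u≡c : u ≡ c
        u≡c = nbrs (proj₁ dd') (adj-sym md) (proj₁ dc) du (Mo-Cr dd' (Cr-sym md×)) (Mo-Cr dd' dc) (c≢m ∘ sym) u≢d' u≢m

      -- The moves `m`, `d`, `c`, s change `M` by 2 - 2 + 2 - 2, where s comes from `second`. The
      -- hypothesis on common neighbours keeps s different from `o`.
      inner-c : ∀ {c o} → o ∈ R → o ≢ d → (∀ {s} → s ∈ X → Common d s → s ≢ o) → Cr d c → c ≢ m → Inner d c o
      inner-c {c} {o} o∈R o≢d apart dc c≢m with second dc c≢m
      ... | s , s∈X , s≢z , ds , ¬cc , cs with partner (⊆R s∈X)
      ... | s' , ss' , s'∉R = h₄ , low₄ , record { tame = tm ; cover = cv } , In-keep o-s (In-keep o-c (flip-In o-d)) , In-keep o-s (flip-In o-c) ,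
              Out-off (apart s∈X (c , proj₁ dc , cs) ∘ sym) (Out-off (∈∉-≢ {X = R} o∈R c∉R) (Out-off o≢d (Out-off (∈∉-≢ {X = R} o∈R m∉R) out-f)))
        where
        s∈R = ⊆R s∈X
        c∉R = uncov-∉ ¬cc
        h₃ = flip c h₂
        h₄ = flip s h₃
        sc× = Cr-sym (uncov-Cr ¬cc cs)
        o-c : Out h₂ c
        o-c = Out-off (adj-≢ (proj₁ dc) ∘ sym) (Out-off c≢m out-f)
        out₃ : ∀ {x} → x ∈ R → x ≢ d → Out h₃ x
        out₃ x∈R x≢d = Out-off (∈∉-≢ {X = R} x∈R c∉R) (Out-off x≢d (Out-off (∈∉-≢ {X = R} x∈R m∉R) out-f))
        out₃' : ∀ {x x'} → Mo x x' → x' ∉ R → x ≢ z → Out h₃ x'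
        out₃' xx' x'∉R x≢z = Out-off (λ { refl → ¬cc (_ , Mo-sym xx') }) (Out-off (∈∉-≢ {X = R} d∈R x'∉R ∘ sym)
          (Out-off (λ { refl → x≢z (Mo-unique (Mo-sym xx') mz) }) out-f))
        o-s : Out h₃ s
        o-s = out₃ s∈R (proj₁ ds ∘ sym)
        low₄ : Low h₄ 0
        low₄ = add₂ (add₁ low₂ o-c (Cr-sym dc) (flip-In o-d)) o-s ss' (out₃' ss' s'∉R s≢z) sc× (flip-In o-c)
        elements : ∀ {x} → In h₄ x → x ≡ s ⊎ x ≡ c ⊎ x ≡ d ⊎ x ≡ m
        elements i with In-flip i
        ... | inj₁ p = inj₁ p
        ... | inj₂ i₃ with In-flip i₃
        ... | inj₁ p = inj₂ (inj₁ p)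
        ... | inj₂ i₂ = inj₂ (inj₂ (elements₂ i₂))
        -- Any other neighbour of `s` in `R` would be a gain; `z` is exempt because its partner `m`
        -- has been moved.
        only-z : ∀ {r} → r ∈ R → Adj s r → r ≡ z
        only-z {r} r∈R sr with r ≟ z | partner r∈R
        ... | yes p | _ = p
        ... | no r≢z | r' , rr' , r'∉R = ⊥-elim (add₂⊥ low₄ (Out-off (adj-≢ sr ∘ sym) (out₃ r∈R (λ { refl → iso s∈R (adj-sym sr) }))) rr'
                (Out-off (∈∉-≢ {X = R} s∈R r'∉R ∘ sym) (out₃' rr' r'∉R r≢z)) (R-Cr r∈R s∈R (adj-sym sr)) (flip-In o-s))
        -- s is quiet unless it is adjacent to z, which is the five-cycle d c s z m.
        tame-s : ∀ {p α} → Mo s p → Adj p α → α ∈ R → Isolated α → α ≡ s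
        tame-s {p} {α} sp pα α∈R iso-α with adj? s z
        ... | yes sz = ⊥-elim (no-double-tail z∈R s∈R (adj-sym sz) zm sp md d∈R iso (H-sym ds) pα α∈R iso-α)
        ... | no ¬sz = quiet s∈R (λ r∈R sr → ¬sz (subst (Adj s) (only-z r∈R sr) sr)) (twoR s∈X) sp pα α∈R
        tm : ∀ {x p α} → In h₄ x → x ∈ R → Mo x p → Adj p α → α ∈ R → Isolated α → α ≡ x
        tm i x∈R xp pα α∈R iso-α with elements i
        ... | inj₁ refl = tame-s xp pα α∈R iso-α
        ... | inj₂ (inj₁ refl) = ⊥-elim (∈∉ {X = R} x∈R c∉R)
        ... | inj₂ (inj₂ (inj₁ refl)) = quiet x∈R iso (twoR d∈X) xp pα α∈R
        ... | inj₂ (inj₂ (inj₂ refl)) = ⊥-elim (∈∉ {X = R} x∈R m∉R)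
        cv : ∀ {x p} → In h₄ x → p ∈ R → Mo p x → Isolated p → ⊥
        cv i p∈R px iso-p with elements i
        ... | inj₁ refl = ∈∉ {X = R} s∈R (Mo-∉ p∈R px)
        ... | inj₂ (inj₁ refl) = ¬cc (_ , Mo-sym px)
        ... | inj₂ (inj₂ (inj₁ refl)) = ∈∉ {X = R} d∈R (Mo-∉ p∈R px)
        ... | inj₂ (inj₂ (inj₂ refl)) with refl ← Mo-unique (Mo-sym px) mz = z-busy iso-p

      inner : ∀ {c o} → o ∈ R → o ≢ d → (∀ {s} → s ∈ X → Common d s → s ≢ o) → Cr d c → Inner d c o
      inner {c} o∈R o≢d apart dc with c ≟ m
      ... | yes refl = inner-m o∈R o≢d
      ... | no c≢m = inner-c o∈R o≢d apart dc c≢m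

    -- Moving `d` costs 2, and the trail from `d` into `c` gains it back. The trail is confined to
    -- `Y` and hubs, so `o` outside `Y` is never moved.
    ring-inner : ∀ {X Y d c o} → Stuck X → NoStar X → HubOnly X → (∀ {y} → y ∈ Y → y ∈ X) → Next Y → d ∈ Y → o ∈ R → o ∉ Y →
                 Cr d c → Inner d c o
    ring-inner {X} {Y} {d} {c} {o} stuck noStar hubOnly Y⊆X next d∈Y o∈R o∉Y dc = h' , low l , record { tame = tm ; cover = cv } , keep (flip-In out-f) , c-in , o-out
      where
      open Stuck stuck
      d∈X = Y⊆X d∈Y
      d∈R = ⊆R d∈X
      d' = proj₁ (partner d∈R)
      dd' = proj₁ (proj₂ (partner d∈R))
      d'∉R = proj₂ (proj₂ (partner d∈R))
      h = flip d f
      -- `Next` yields two different steps from `d`; with the partner they exhaust its neighbours,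
      -- so `c` is one of them.
      st : Step Y d c
      st with next d d∈Y
      ... | c₁ , _ , s₁ with next c₁ d∈Y
      ... | c₂ , c₂≢c₁ , s₂ with c ≟ c₁
      ... | yes refl = s₁
      ... | no c≢c₁ = subst (Step Y d) (sym (nbrs (proj₁ dd') (proj₁ (Step-Cr s₁)) (proj₁ (Step-Cr s₂)) (proj₁ dc)
              (Mo-Cr dd' (Step-Cr s₁)) (Mo-Cr dd' (Step-Cr s₂)) (c₂≢c₁ ∘ sym) (Mo-Cr dd' dc ∘ sym) c≢c₁)) s₂
      t = trail (⊆R ∘ Y⊆X) next (card (outs h)) ≤-refl (flip-In out-f) (Out-off (adj-≢ (proj₁ dc) ∘ sym) out-f) st
            (λ q m → Out-off (∈∉-≢ {X = R} d∈R (Mo-∉ (⊆R (Y⊆X q)) m) ∘ sym) out-f)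
      h' = proj₁ t
      l : M h' ≤ 0 + M f
      l = +-cancelˡ-≤ 2 _ _ (≤-trans (proj₁ (proj₂ t)) (Low.bound (start dd')))
      keep : ∀ {s} → In h s → In h' s
      keep = proj₁ (proj₂ (proj₂ t))
      c-in = proj₁ (proj₂ (proj₂ (proj₂ t)))
      elements : ∀ {s} → In h' s → s ∈ Y ⊎ ¬ Cov s
      elements i with proj₂ (proj₂ (proj₂ (proj₂ t))) i
      ... | inj₂ q = q
      ... | inj₁ j with In-flip j
      ... | inj₁ refl = inj₁ d∈Y
      ... | inj₂ k = ⊥-elim (In-Out k out-f refl)
      tm : ∀ {x p α} → In h' x → x ∈ R → Mo x p → Adj p α → α ∈ R → Isolated α → α ≡ x
      tm i x∈R xp pα α∈R _ with elements i
      ... | inj₁ x∈Y = quiet x∈R (ring-isolated stuck noStar hubOnly (Y⊆X x∈Y)) (twoR (Y⊆X x∈Y)) xp pα α∈R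
      ... | inj₂ ¬c = ⊥-elim (¬c (_ , xp))
      cv : ∀ {x p} → In h' x → p ∈ R → Mo p x → Isolated p → ⊥
      cv i p∈R px _ with elements i
      ... | inj₁ x∈Y = ∈∉ {X = R} (⊆R (Y⊆X x∈Y)) (Mo-∉ p∈R px)
      ... | inj₂ ¬c = ¬c (_ , Mo-sym px)
      o-out : Out h' o
      o-out with in? h' o
      ... | inj₂ q = q
      ... | inj₁ i with elements i
      ... | inj₁ o∈Y = ⊥-elim (∈∉ {X = Y} o∈Y o∉Y)
      ... | inj₂ ¬c = ⊥-elim (∈∉ {X = R} o∈R (uncov-∉ ¬c))

    -- Moving `b` costs 2 and moving `d` gains 2, so the larger set breaks even and contains `d`;
    -- the structure that made `d` a token then offers one more gain. If `b` is moved already, `d`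
    -- itself is that gain.
    bridge : ∀ {X h a b d} → Stuck X → Low h 0 → Clean h → In h a → Cr b a → b ∉ R → Cr d b → d ∈ X → Token X d → Out h d → ⊥
    bridge {X} {h} {a} {b} {d} stuck l clean a-in ba b∉R db d∈X tok o-d = contra (in? h b)
      where
      open Stuck stuck
      open Clean clean
      d∈R = ⊆R d∈X
      iso = isolated stuck d∈X tok
      d' = proj₁ (partner d∈R)
      dd' = proj₁ (proj₂ (partner d∈R))
      d'∉R = proj₂ (proj₂ (partner d∈R))
      o-d' : Out h d'
      o-d' = partner-out d∈R iso dd'
      module Fresh (o-b : Out h b) where
        -- With an unmoved partner, `b` would be a gain. A moved partner would be `d` by `tame`, but
        -- `d` is unmoved.
        ¬cb : ¬ Cov b
        ¬cb (p , bp) with in? h p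
        ... | inj₂ o-p = add₂⊥ l o-b bp o-p ba a-in
        ... | inj₁ i-p = In-Out i-p o-d (sym (tame i-p (Mo-∈ b∉R bp) (Mo-sym bp) (adj-sym (proj₁ db)) d∈R iso))
        h₁ = flip b h
        h₂ = flip d h₁
        l₁ : Low h₁ 2
        l₁ = add₁ l o-b ba a-in
        b-in : In h₁ b
        b-in = flip-In o-b
        o₁-d : Out h₁ d
        o₁-d = Out-off (adj-≢ (proj₁ db)) o-d
        out₁-p : ∀ {x p} → x ∈ R → Isolated x → Mo x p → Out h₁ p
        out₁-p x∈R iso-x xp = Out-off (λ { refl → ¬cb (_ , Mo-sym xp) }) (partner-out x∈R iso-x xp)
        out₂-p : ∀ {x p} → x ∈ R → Isolated x → Mo x p → Out h₂ p
        out₂-p x∈R iso-x xp = Out-off (∈∉-≢ {X = R} d∈R (Mo-∉ x∈R xp) ∘ sym) (out₁-p x∈R iso-x xp)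
        l₂ : Low h₂ 0
        l₂ = add₂ l₁ o₁-d dd' (out₁-p d∈R iso dd') db b-in
        d-in : In h₂ d
        d-in = flip-In o₁-d
        b-in₂ : In h₂ b
        b-in₂ = In-keep o₁-d b-in
        -- Otherwise `d` would have three monochromatic edges: to its partner, to `b` and to `c`.
        fresh : ∀ {c} → Cr d c → c ≢ b → Out h₂ c
        fresh {c} dc c≢b with in? h c
        ... | inj₁ i = ⊥-elim (three⊥ l₁ o₁-d dd' (out₁-p d∈R iso dd') db b-in dc (In-keep o-b i) (c≢b ∘ sym))
        ... | inj₂ o = Out-off (adj-≢ (proj₁ dc) ∘ sym) (Out-off c≢b o)
        -- If `x` is moved, `b` has two moved neighbours; if not, `x` is a gain next to `b`.
        third : ∀ {x} → x ∈ R → Isolated x → Cr x b → x ≢ d → x ≢ a → ⊥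
        third {x} x∈R iso-x xb x≢d x≢a with in? h x | partner x∈R
        ... | inj₁ i | _ = two⊥ l o-b ba a-in (Cr-sym xb) i (x≢a ∘ sym)
        ... | inj₂ o | x' , xx' , _ = add₂⊥ l₂ (Out-off x≢d (Out-off (adj-≢ (proj₁ xb)) o)) xx' (out₂-p x∈R iso-x xx') xb b-in₂
        module AtStar {u x y} (s : Star R u d x y) where
          open Star s using () renaming (b∈R to x∈R; c∈R to y∈R; ua to ud; ub to ux; uc to uy; a≢b to d≢x; a≢c to d≢y; b≢c to x≢y)
          open StarSet s using (¬cov; u∉R)
          cr : ∀ {v} → Adj u v → Cr u v
          cr = uncov-Cr ¬cov
          -- At most one of the leaves `x`, `y` is `a`; the other is a third neighbour of `b`.
          at-b : u ≡ b → ⊥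
          at-b refl with x ≟ a
          ... | no x≢a = third x∈R (star-isolated₁ s) (Cr-sym (cr ux)) (d≢x ∘ sym) x≢a
          ... | yes refl = third y∈R (star-isolated₂ s) (Cr-sym (cr uy)) (d≢y ∘ sym) (x≢y ∘ sym)
          -- Moving `u` costs 2, and then both leaves gain 2. A leaf that is moved already makes `u`
          -- a gain at once.
          off-b : u ≢ b → ⊥
          off-b u≢b with in? h₂ x | in? h₂ y | partner x∈R | partner y∈R
          ... | inj₁ i | _ | _ | _ = two⊥ l₂ (fresh (Cr-sym (cr ud)) u≢b) (cr ud) d-in (cr ux) i d≢x
          ... | _ | inj₁ i | _ | _ = two⊥ l₂ (fresh (Cr-sym (cr ud)) u≢b) (cr ud) d-in (cr uy) i d≢y
          ... | inj₂ o-x | inj₂ o-y | x' , xx' , x'∉R | y' , yy' , y'∉R =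
            add₂⊥ (add₂ (add₁ l₂ o-u (cr ud) d-in) o₃-x xx' (Out-off (λ { refl → ¬cov (_ , Mo-sym xx') }) (out₂-p x∈R (star-isolated₁ s) xx'))
                (Cr-sym (cr ux)) (flip-In o-u))
              (Out-off (x≢y ∘ sym) (Out-off (∈∉-≢ {X = R} y∈R u∉R) o-y)) yy'
              (Out-off (∈∉-≢ {X = R} x∈R y'∉R ∘ sym) (Out-off (λ { refl → ¬cov (_ , Mo-sym yy') }) (out₂-p y∈R (star-isolated₂ s) yy')))
              (Cr-sym (cr uy)) (In-keep o₃-x (flip-In o-u))
            where
            o-u = fresh (Cr-sym (cr ud)) u≢b
            o₃-x : Out (flip u h₂) x
            o₃-x = Out-off (∈∉-≢ {X = R} x∈R u∉R) o-x
        at : Token X d → ⊥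
        at (star u x y _ _ s) with u ≟ b
        ... | yes p = AtStar.at-b s p
        ... | no p = AtStar.off-b s p
        at (head z m z∈X zm md d≢z ¬dz) = add₂⊥ l₂ (fresh (Cr-sym md×) (λ { refl → ¬cb (z , mz) })) mz o-z md× d-in
          where
          mz = Mo-sym zm
          z∈R = ⊆R z∈X
          md× = Cr-≢Mo mz md d≢z
          o-z : Out h₂ z
          o-z with in? h z
          ... | inj₁ i = ⊥-elim (d≢z (tame i z∈R zm md d∈R iso))
          ... | inj₂ o = Out-off (d≢z ∘ sym) (Out-off (∈∉-≢ {X = R} z∈R b∉R) o)
        at (ring noStar hubOnly) with hub-next stuck noStar hubOnly b d∈X
        ... | c , c≢b , st = none (proj₁ t) (≤-trans (proj₁ (proj₂ t)) (Low.bound l₂))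
          where
          t = trail ⊆R (hub-next stuck noStar hubOnly) (card (outs h₂)) ≤-refl d-in (fresh (Step-Cr st) c≢b) st
                (λ q m → out₂-p (⊆R q) (ring-isolated stuck noStar hubOnly q) m)
      contra : In h b ⊎ Out h b → ⊥
      contra (inj₁ i) = add₂⊥ l o-d dd' o-d' db i
      contra (inj₂ o) = Fresh.at o tok

    -- The set breaks even, so only the validity of `R` for the new cut is in question. All
    -- neighbours of the centre belong to the set, so every edge leaving it starts at a leaf, and
    -- leaves are in `R`.
    star-optimal : ∀ {u d a b} (s : Star R u d a b) → Optimal (StarSet.set s) R
    star-optimal {u} {d} {a} {b} s = record
      { valid = λ x y xy → ok x y xy (in? set x) (in? set y)
      ; M-min = λ h → ≤-trans M≤ (M-min h)
      ; card-min = λ h R' le → card-min h R' (≤-trans le M≤)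
      ; e-min = λ h R' le → e-min h R' (≤-trans le M≤) }
      where
      open Star s renaming (a∈R to d∈R; b∈R to a∈R; c∈R to b∈R; ua to ud; ub to ua; uc to ub; a≢b to d≢a; a≢c to d≢b; b≢c to a≢b)
      open StarSet s
      M≤ : M set ≤ M f
      M≤ = Low.bound isLow
      boundary : ∀ {x y} → In set x → Out set y → Adj x y → x ∈ R
      boundary i o xy with elements i
      ... | inj₁ refl = d∈R
      ... | inj₂ (inj₁ refl) = a∈R
      ... | inj₂ (inj₂ (inj₁ refl)) = b∈R
      ... | inj₂ (inj₂ (inj₂ refl)) = ⊥-elim (In-Out in-b o (sym (nbrs ud ua ub xy d≢a d≢b a≢b (In-Out in-d o ∘ sym) (In-Out in-a o ∘ sym))))
      ok : ∀ x y → Adj x y × set x ≡ set y → In set x ⊎ Out set x → In set y ⊎ Out set y → x ∈ R ⊎ y ∈ R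
      ok x y (xy , p) (inj₁ i) (inj₁ j) = valid x y (xy , Boolₚ.not-injective (trans (sym (In.side i)) (trans p (In.side j))))
      ok x y (xy , p) (inj₂ i) (inj₂ j) = valid x y (xy , trans (sym (Out.side i)) (trans p (Out.side j)))
      ok x y (xy , p) (inj₁ i) (inj₂ j) = inj₁ (boundary i j xy)
      ok x y (xy , p) (inj₂ i) (inj₁ j) = inj₂ (boundary j i (adj-sym xy))

  -- A star may be flipped as a whole, so its vertices can be matched to either of their other two neighbours.

  align : ∀ {f R u d x y a} → Optimal f R → Star R u d x y → Adj d a → a ∉ R → a ≢ u →
          ∃ λ f' → Optimal f' R × f' d ≡ f' a × (∀ {s} → s ≢ d → s ≢ x → s ≢ y → s ≢ u → f' s ≡ f s)
  align {f} {R} {u} {d} {x} {y} {a} opt s da a∉R a≢u with f d Boolₚ.≟ f a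
  ... | yes p = f , opt , p , λ _ _ _ _ → refl
  ... | no ¬p = set , star-optimal s , trans (In.side in-d) (trans (sym (Boolₚ.¬-not (¬p ∘ sym))) (sym (Out.side (out-∉ a∉R a≢u)))) ,
                λ s≢d s≢x s≢y s≢u → Out.side (out s≢d s≢x s≢y s≢u)
    where
    open Structure f R opt
    open StarSet s

  module Conflict (f R : Fin n → Bool) (opt : Optimal f R) where
    open Structure f R opt

    -- Conflicts between tokens

    -- The neighbours of `d` outside `R` that are its partner, or can be made so by flipping a star.
    data Exit (d a : Fin n) : Set where
      matched : f d ≡ f a → Exit d a
      outer : ∀ {u x y} → Star R u d x y → a ≢ u → Exit d a

    -- After at most two star flips `a` and `b` are the partners of `d` and `d'` in one optimal cut,
    -- where `twin-exits` applies. The absence of a common neighbour keeps each star disjoint from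
    -- the other token and its exit, so one alignment does not disturb the other.
    exits-meet : ∀ {d a d' b} → d ∈ R → d' ∈ R → Isolated d → Isolated d' → Two R d → Two R d' → d ≢ d' → ¬ Common d d' →
                 Adj d a → Adj a b → Adj b d' → a ∉ R → b ∉ R → Exit d a → Exit d' b → ⊥
    exits-meet {d} {a} {d'} {b} d∈R d'∈R iso iso' two two' d≢d' ¬c da ab bd' a∉R b∉R = cases
      where
      finish : ∀ {f'} → Optimal f' R → f' d ≡ f' a → f' d' ≡ f' b → ⊥
      finish opt' p q = Structure.twin-exits _ R opt' d∈R d'∈R iso iso' two two' (da , p) (adj-sym bd' , q) ab d≢d' ¬c
      module _ {u x y} (s : Star R u d x y) where
        open Star s using () renaming (b∈R to x∈R; c∈R to y∈R; ua to ud; ub to ux; uc to uy)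
        d'-off : d' ≢ x × d' ≢ y × d' ≢ u
        d'-off = (λ { refl → ¬c (u , adj-sym ud , ux) }) , (λ { refl → ¬c (u , adj-sym ud , uy) }) , ∈∉-≢ {X = R} d'∈R (StarSet.u∉R s)
        b-off : b ≢ d × b ≢ x × b ≢ y × b ≢ u
        b-off = ∈∉-≢ {X = R} d∈R b∉R ∘ sym , ∈∉-≢ {X = R} x∈R b∉R ∘ sym , ∈∉-≢ {X = R} y∈R b∉R ∘ sym , (λ { refl → ¬c (u , adj-sym ud , bd') })
      module _ {u x y} (s : Star R u d' x y) where
        open Star s using () renaming (b∈R to x∈R; c∈R to y∈R; ua to ud; ub to ux; uc to uy)
        d-off : d ≢ x × d ≢ y × d ≢ u
        d-off = (λ { refl → ¬c (u , adj-sym ux , ud) }) , (λ { refl → ¬c (u , adj-sym uy , ud) }) , ∈∉-≢ {X = R} d∈R (StarSet.u∉R s)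
        a-off : a ≢ d' × a ≢ x × a ≢ y × a ≢ u
        a-off = ∈∉-≢ {X = R} d'∈R a∉R ∘ sym , ∈∉-≢ {X = R} x∈R a∉R ∘ sym , ∈∉-≢ {X = R} y∈R a∉R ∘ sym , (λ { refl → ¬c (u , da , ud) })
      then : ∀ {f'} → Optimal f' R → f' d ≡ f' a → ∀ {u x y} → Star R u d' x y → b ≢ u → ⊥
      then opt' p s b≢u with align opt' s (adj-sym bd') b∉R b≢u
      ... | f'' , opt'' , q , same = finish opt'' (trans (same d≢d' (proj₁ o) (proj₁ (proj₂ o)) (proj₂ (proj₂ o)))
              (trans p (sym (same (proj₁ o') (proj₁ (proj₂ o')) (proj₁ (proj₂ (proj₂ o'))) (proj₂ (proj₂ (proj₂ o'))))))) q
        where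
        o = d-off s
        o' = a-off s
      cases : Exit d a → Exit d' b → ⊥
      cases (matched p) (matched q) = finish opt p q
      cases (matched p) (outer s b≢u) = then opt p s b≢u
      cases (outer s a≢u) e' with align opt s da a∉R a≢u
      cases (outer s a≢u) (outer s' b≢u) | f' , opt' , p , _ = then opt' p s' b≢u
      cases (outer s a≢u) (matched q) | f' , opt' , p , same = finish opt' p
        (trans (same (d≢d' ∘ sym) (proj₁ o) (proj₁ (proj₂ o)) (proj₂ (proj₂ o)))
          (trans q (sym (same (proj₁ o') (proj₁ (proj₂ o')) (proj₁ (proj₂ (proj₂ o'))) (proj₂ (proj₂ (proj₂ o')))))))
        where
        o = d'-off s
        o' = b-off s

    Far : Fin n → Fin n → Set
    Far d d' = ¬ Adj d d' × ¬ Common d d' × (∀ {a b} → Adj d a → Adj a b → Adj b d' → ⊥)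

    -- Two tokens, `d₂` being taken from a stuck set reached after the removal of `d₁`.

    module _ {X₁ X₂ : Fin n → Bool} {d₁ d₂ : Fin n} (stuck₁ : Stuck X₁) (stuck₂ : Stuck X₂) (X₂⊆X₁ : ∀ {x} → x ∈ X₂ → x ∈ X₁)
             (d₁∈X₁ : d₁ ∈ X₁) (d₁∉X₂ : d₁ ∉ X₂) (d₂∈X₂ : d₂ ∈ X₂) (tok₁ : Token X₁ d₁) (tok₂ : Token X₂ d₂) where

      private
        module S₁ = Stuck stuck₁
        module S₂ = Stuck stuck₂
        d₁∈R = S₁.⊆R d₁∈X₁
        d₂∈R = S₂.⊆R d₂∈X₂
        iso₁ : Isolated d₁
        iso₁ = isolated stuck₁ d₁∈X₁ tok₁
        iso₂ : Isolated d₂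
        iso₂ = isolated stuck₂ d₂∈X₂ tok₂
        d₂≢d₁ : d₂ ≢ d₁
        d₂≢d₁ = ∈∉-≢ {X = X₂} d₂∈X₂ d₁∉X₂

        ∉R : ∀ {d x} → Isolated d → Adj d x → x ∉ R
        ∉R {x = x} iso dx with R x in eq
        ... | false = refl
        ... | true = ⊥-elim (iso eq dx)

        -- A trail of a ring token `d₁` has to avoid `d₂`; this part of `X₁` contains `d₁` and is
        -- closed under ring steps.
        Y : Fin n → Bool
        Y x = if X₂ x then false else X₁ x

        Y-∈ : ∀ {x} → x ∈ Y → x ∈ X₁ × x ∉ X₂
        Y-∈ {x} p with X₂ x
        ... | false = p , refl

        ∈-Y : ∀ {x} → x ∈ X₁ → x ∉ X₂ → x ∈ Y
        ∈-Y {x} p q = trans (cong (λ b → if b then false else X₁ x) q) p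

        -- Suppose the hub `c` leads from `v` to some `r` in `X₂`. Within `X₂` the vertex `r` uses
        -- two hubs, which with its partner exhaust its neighbours, so `c` is one of them. Then `c`
        -- is adjacent to `v`, `r` and a further vertex of `X₂`, a star in `X₁`.
        Y-next : NoStar X₁ → HubOnly X₁ → Next Y
        Y-next noStar hubOnly {v} u v∈Y with hub-next stuck₁ noStar hubOnly u (proj₁ (Y-∈ v∈Y))
        ... | c , c≢u , inj₁ (c∈X , vc) = ⊥-elim (ring-isolated stuck₁ noStar hubOnly (proj₁ (Y-∈ v∈Y)) (S₁.⊆R c∈X) (proj₁ vc))
        ... | c , c≢u , inj₂ (¬c , vc , r , r∈X , r≢v , cr) with X₂ r in r∈X₂
        ...   | false = c , c≢u , inj₂ (¬c , vc , r , ∈-Y r∈X r∈X₂ , r≢v , cr)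
        ...   | true = ⊥-elim (closed (hubs stuck₂ (λ p q s → noStar (X₂⊆X₁ p) (X₂⊆X₁ q) (X₂⊆X₁ s)) (λ p q → hubOnly (X₂⊆X₁ p) (X₂⊆X₁ q)) r∈X₂))
          where
          v∉X₂ = proj₂ (Y-∈ v∈Y)
          r' = proj₁ (partner (S₁.⊆R r∈X))
          rr' = proj₁ (proj₂ (partner (S₁.⊆R r∈X)))
          same-hub : ∀ {s} → s ∈ X₂ → s ≢ r → Adj c s → ⊥
          same-hub {s} s∈X₂ s≢r cs = noStar (proj₁ (Y-∈ v∈Y)) r∈X (X₂⊆X₁ s∈X₂) (adj-sym vc) cr cs (r≢v ∘ sym)
            (∈∉-≢ {X = X₂} s∈X₂ v∉X₂ ∘ sym) (s≢r ∘ sym)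
          closed : (∃ λ c₁ → ∃ λ c₂ → ∃ λ r₁ → ∃ λ r₂ →
             c₁ ≢ c₂ × (¬ Cov c₁ × Adj r c₁ × Adj c₁ r₁) × (¬ Cov c₂ × Adj r c₂ × Adj c₂ r₂) ×
             (r₁ ∈ X₂ × r₁ ≢ r) × (r₂ ∈ X₂ × r₂ ≢ r) × r₁ ≢ r₂) → ⊥
          closed (c₁ , c₂ , r₁ , r₂ , c₁≢c₂ , (¬c₁ , rc₁ , c₁r₁) , (¬c₂ , rc₂ , c₂r₂) , (r₁∈X₂ , r₁≢r) , (r₂∈X₂ , r₂≢r) , _) with c ≟ c₁
          ... | yes refl = same-hub r₁∈X₂ r₁≢r c₁r₁
          ... | no c≢c₁ with refl ← nbrs (proj₁ rr') rc₁ rc₂ (adj-sym cr) (λ { refl → ¬c₁ (_ , Mo-sym rr') }) (λ { refl → ¬c₂ (_ , Mo-sym rr') }) c₁≢c₂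
                                      (λ { refl → ¬c (_ , Mo-sym rr') }) c≢c₁ = same-hub r₂∈X₂ r₂≢r c₂r₂

      -- Both edges at a common neighbour m cross, by `quiet`. If a break-even set around `d₂`
      -- contains m, then `d₁` is a gain next to it. Otherwise `d₂` belongs to a star centred
      -- elsewhere, whose set is bridged to `d₁` through m.
      not-common : ¬ Common d₁ d₂
      not-common (m , d₁m , md₂) = by tok₂
        where
        m∉R = ∉R iso₁ d₁m
        m× : Cr m d₁
        m× with Mo⊎Cr d₁m
        ... | inj₁ q = ⊥-elim (d₂≢d₁ (quiet d₁∈R iso₁ (S₁.twoR d₁∈X₁) q md₂ d₂∈R))
        ... | inj₂ q = Cr-sym q
        m×₂ : Cr m d₂
        m×₂ with Mo⊎Cr md₂
        ... | inj₁ q = ⊥-elim (d₂≢d₁ (sym (quiet d₂∈R iso₂ (S₂.twoR d₂∈X₂) (Mo-sym q) (adj-sym d₁m) d₁∈R)))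
        ... | inj₂ q = q
        direct : Inner d₂ m d₁ → ⊥
        direct (h , l , clean , _ , m-in , o) with partner d₁∈R
        ... | d₁' , m₁ , _ = add₂⊥ l o m₁ (Clean.partner-out clean d₁∈R iso₁ m₁) (Cr-sym m×) m-in
        by : Token X₂ d₂ → ⊥
        by (star u x y x∈X y∈X s) = go (u ≟ m)
          where
          open StarSet s
          o : Out set d₁
          o = out (d₂≢d₁ ∘ sym) (∈∉-≢ {X = X₂} x∈X d₁∉X₂ ∘ sym) (∈∉-≢ {X = X₂} y∈X d₁∉X₂ ∘ sym) (∈∉-≢ {X = R} d₁∈R u∉R)
          clean = star-clean stuck₂ d₂∈X₂ x∈X y∈X s
          go : Dec (u ≡ m) → ⊥
          go (yes refl) = direct (set , isLow , clean , in-d , in-u , o)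
          go (no u≢m) = bridge stuck₁ isLow clean in-d m×₂ m∉R (Cr-sym m×) d₁∈X₁ tok₁ o
        by (head z k z∈X zk kd d≢z ¬dz) = direct (Head.inner stuck₂ d₂∈X₂ z∈X zk kd d≢z ¬dz d₁∈R (d₂≢d₁ ∘ sym)
          (λ s∈X _ → ∈∉-≢ {X = X₂} s∈X d₁∉X₂) (Cr-sym m×₂))
        by (ring noStar hubOnly) = direct (ring-inner stuck₂ noStar hubOnly (λ p → p) (hub-next stuck₂ noStar hubOnly) d₂∈X₂ d₁∈R d₁∉X₂ (Cr-sym m×₂))

      private
        Route : Fin n → Fin n → Fin n → Set
        Route d a o = Exit d a ⊎ Inner d a o

        -- The centre has all its neighbours in `R`, so it cannot lead on to `b`.
        star-route : ∀ {u d x y a b o} → Star R u d x y → Adj a b → b ∉ R → Route d a o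
        star-route {u} {a = a} s ab b∉R with a ≟ u
        ... | no a≢u = inj₁ (outer s a≢u)
        ... | yes refl = ⊥-elim (∈∉ {X = R} c∈R (subst (_∉ R) (nbrs ua ub uc ab a≢b a≢c b≢c (∈∉-≢ {X = R} a∈R b∉R ∘ sym) (∈∉-≢ {X = R} b∈R b∉R ∘ sym)) b∉R))
          where open Star s

        route₁ : ∀ {a b} → Adj d₁ a → Adj a b → b ∉ R → Token X₁ d₁ → Route d₁ a d₂
        route₁ {a} d₁a ab b∉R tok with Mo⊎Cr d₁a | tok
        ... | inj₁ q | _ = inj₁ (matched (proj₂ q))
        ... | inj₂ q | star u x y _ _ s = star-route s ab b∉R
        ... | inj₂ q | head z k z∈X zk kd d≢z ¬dz =
              inj₂ (Head.inner stuck₁ d₁∈X₁ z∈X zk kd d≢z ¬dz d₂∈R d₂≢d₁ (λ { _ c refl → not-common c }) q)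
        ... | inj₂ q | ring noStar hubOnly = inj₂ (ring-inner stuck₁ noStar hubOnly (proj₁ ∘ Y-∈) (Y-next noStar hubOnly)
                (∈-Y d₁∈X₁ d₁∉X₂) d₂∈R (cong (λ b → if b then false else X₁ d₂) d₂∈X₂) q)

        route₂ : ∀ {a b} → Adj d₂ b → Adj b a → a ∉ R → Token X₂ d₂ → Route d₂ b d₁
        route₂ {a} d₂b ba a∉R tok with Mo⊎Cr d₂b | tok
        ... | inj₁ q | _ = inj₁ (matched (proj₂ q))
        ... | inj₂ q | star u x y _ _ s = star-route s ba a∉R
        ... | inj₂ q | head z k z∈X zk kd d≢z ¬dz =
              inj₂ (Head.inner stuck₂ d₂∈X₂ z∈X zk kd d≢z ¬dz d₁∈R (d₂≢d₁ ∘ sym) (λ s∈X _ → ∈∉-≢ {X = X₂} s∈X d₁∉X₂) q)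
        ... | inj₂ q | ring noStar hubOnly =
              inj₂ (ring-inner stuck₂ noStar hubOnly (λ p → p) (hub-next stuck₂ noStar hubOnly) d₂∈X₂ d₁∈R d₁∉X₂ q)

        -- If `ob` crosses, this is `bridge`. Otherwise `b` is the partner of `o` and a gain next to
        -- `a`.
        blocked : ∀ {X d a b o} → Stuck X → o ∈ X → Token X o → Inner d a o → Cr b a → b ∉ R → Adj o b → ⊥
        blocked stuck o∈X tok (h , l , clean , _ , a-in , out-o) ba b∉R ob with Mo⊎Cr ob
        ... | inj₂ q = bridge stuck l clean a-in ba b∉R q o∈X tok out-o
        ... | inj₁ q = add₂⊥ l (Clean.partner-out clean (Stuck.⊆R stuck o∈X) (isolated stuck o∈X tok) q) (Mo-sym q) out-o ba a-in

      far : Far d₁ d₂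
      far = iso₁ d₂∈R , not-common , three
        where
        three : ∀ {a b} → Adj d₁ a → Adj a b → Adj b d₂ → ⊥
        three {a} {b} d₁a ab bd₂ = go (route₁ d₁a ab b∉R tok₁) (route₂ (adj-sym bd₂) (adj-sym ab) a∉R tok₂)
          where
          a∉R = ∉R iso₁ d₁a
          b∉R = ∉R iso₂ (adj-sym bd₂)
          ab× = B-Cr a∉R b∉R ab
          go : Route d₁ a d₂ → Route d₂ b d₁ → ⊥
          go (inj₂ i) _ = blocked stuck₂ d₂∈X₂ tok₂ i (Cr-sym ab×) b∉R (adj-sym bd₂)
          go _ (inj₂ i) = blocked stuck₁ d₁∈X₁ tok₁ i ab× a∉R d₁a
          go (inj₁ x) (inj₁ y) = exits-meet d₁∈R d₂∈R iso₁ iso₂ (S₁.twoR d₁∈X₁) (S₂.twoR d₂∈X₂) (d₂≢d₁ ∘ sym) not-common d₁a ab bd₂ a∉R b∉R x y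

    Far-sym : ∀ {d d'} → Far d d' → Far d' d
    Far-sym (¬a , ¬c , ¬t) = ¬a ∘ adj-sym , (λ { (u , p , q) → ¬c (u , adj-sym q , adj-sym p) }) , λ p q r → ¬t (adj-sym r) (adj-sym q) (adj-sym p)

    -- Peeling

    record Peeling (X : Fin n → Bool) : Set where
      field
        κ D : Fin n → Bool
        -- Each token remembers the stuck set it came from, so that it can be compared with tokens
        -- removed before it.
        D-token : ∀ {d} → d ∈ D → ∃ λ X' → Stuck X' × (∀ {x} → x ∈ X' → x ∈ X) × d ∈ X' × Token X' d
        proper : ∀ {u v} → u ∈ X → v ∈ X → u ∉ D → v ∉ D → H u v → κ u ≢ κ v
        spread : ∀ {d d'} → d ∈ D → d' ∈ D → d ≢ d' → Far d d'

    peel : ∀ k X → card X ≤ k → (∀ {x} → x ∈ X → x ∈ R) → Peeling X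
    peel k X le X⊆R with any? (λ v → ∈? X v ×-dec ¬? (two? X v))
    ... | yes (v , v∈X , ¬two) = leaf k le
      where
      X' = remove v X
      leaf : ∀ k → card X ≤ k → Peeling X
      leaf zero le = ⊥-elim (<⇒≱ (s≤s z≤n) (≤-trans (≤-reflexive (sym (card-remove v X v∈X))) le))
      leaf (suc k) le = extend (any? (λ r → ∈? X' r ×-dec H? v r))
        where
        module P = Peeling (peel k X' (+-cancelˡ-≤ 1 _ _ (≤-trans (≤-reflexive (sym (card-remove v X v∈X))) le)) (X⊆R ∘ proj₂ ∘ ∈-remove X))
        recolour : (b : Bool) → (∀ {r} → r ∈ X' → H v r → P.κ r ≢ b) → Peeling X
        recolour b ok = record
          { κ = κ' ; D = P.D
          ; D-token = λ d∈D → let (Z , st , sub , q) = P.D-token d∈D in Z , st , (λ z → proj₂ (∈-remove X (sub z))) , q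
          ; proper = proper'
          ; spread = P.spread }
          where
          κ' = updateAt P.κ v (const b)
          proper' : ∀ {u w} → u ∈ X → w ∈ X → u ∉ P.D → w ∉ P.D → H u w → κ' u ≢ κ' w
          proper' {u} {w} u∈X w∈X u∉D w∉D uw eq with u ≟ v | w ≟ v
          ... | yes refl | yes refl = proj₁ uw refl
          ... | yes refl | no w≢v = ok (remove-∈ X w≢v w∈X) uw (trans (sym (updateAt-minimal w v P.κ w≢v)) (trans (sym eq) (updateAt-updates v P.κ)))
          ... | no u≢v | yes refl = ok (remove-∈ X u≢v u∈X) (H-sym uw) (trans (sym (updateAt-minimal u v P.κ u≢v)) (trans eq (updateAt-updates v P.κ)))
          ... | no u≢v | no w≢v = P.proper (remove-∈ X u≢v u∈X) (remove-∈ X w≢v w∈X) u∉D w∉D uw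
                  (trans (sym (updateAt-minimal u v P.κ u≢v)) (trans eq (updateAt-minimal w v P.κ w≢v)))
        extend : Dec (∃ λ r → r ∈ X' × H v r) → Peeling X
        extend (no ¬r) = recolour false (λ r∈X' vr _ → ¬r (_ , r∈X' , vr))
        extend (yes (r , r∈X' , vr)) = recolour (not (P.κ r)) ok
          where
          ok : ∀ {s} → s ∈ X' → H v s → P.κ s ≢ not (P.κ r)
          ok {s} s∈X' vs with s ≟ r
          ... | yes refl = Boolₚ.not-¬ refl
          ... | no s≢r = ⊥-elim (¬two (r , s , proj₂ (∈-remove X r∈X') , proj₂ (∈-remove X s∈X') , s≢r ∘ sym , vr , vs))
    ... | no ¬leaf with any? (∈? X)
    ...   | no ¬x = record { κ = const false ; D = const false ; D-token = λ () ; proper = λ u∈X → ⊥-elim (¬x (_ , u∈X)) ; spread = λ () }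
    ...   | yes (x , x∈X) = choose k le
      where
      stuck : Stuck X
      stuck = record { ⊆R = X⊆R ; two = λ {v} v∈X → decidable-stable (two? X v) (λ ¬two → ¬leaf (v , v∈X , ¬two)) }
      d = proj₁ (token stuck x∈X)
      d∈X = proj₁ (proj₂ (token stuck x∈X))
      tok = proj₂ (proj₂ (token stuck x∈X))
      X' = remove d X
      choose : ∀ k → card X ≤ k → Peeling X
      choose zero le = ⊥-elim (<⇒≱ (s≤s z≤n) (≤-trans (≤-reflexive (sym (card-remove d X d∈X))) le))
      choose (suc k) le = record
        { κ = P.κ ; D = D
        ; D-token = D-token
        ; proper = λ {u} {v} u∈X v∈X u∉D v∉D → P.proper (remove-∈ X (≢d u∉D) u∈X) (remove-∈ X (≢d v∉D) v∈X) (∉PD u∉D) (∉PD v∉D)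
        ; spread = spread }
        where
        module P = Peeling (peel k X' (+-cancelˡ-≤ 1 _ _ (≤-trans (≤-reflexive (sym (card-remove d X d∈X))) le)) (X⊆R ∘ proj₂ ∘ ∈-remove X))
        D = insert d P.D
        ≢d : ∀ {u} → u ∉ D → u ≢ d
        ≢d u∉D refl = ∈∉ {X = D} (updateAt-updates d P.D) u∉D
        ∉PD : ∀ {u} → u ∉ D → u ∉ P.D
        ∉PD {u} u∉D = trans (sym (updateAt-minimal u d P.D (≢d u∉D))) u∉D
        far-d : ∀ {d'} → d' ∈ P.D → Far d d'
        far-d d'∈D with P.D-token d'∈D
        -- `d` was removed before `Z` was reached, so `X` and `Z` play the parts of the larger and
        -- the smaller stuck set.
        ... | Z , st , sub , d'∈Z , tok' = far stuck st (proj₂ ∘ ∈-remove X ∘ sub) d∈X d∉Z d'∈Z tok tok'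
          where
          d∉Z : d ∉ Z
          d∉Z with Z d in eq
          ... | false = refl
          ... | true = ⊥-elim (proj₁ (∈-remove X (sub eq)) refl)
        D-token : ∀ {d'} → d' ∈ D → ∃ λ Z → Stuck Z × (∀ {x} → x ∈ Z → x ∈ X) × d' ∈ Z × Token Z d'
        D-token d'∈D with ∈-insert P.D d'∈D
        ... | inj₁ refl = X , stuck , (λ p → p) , d∈X , tok
        ... | inj₂ q = let (Z , st , sub , r) = P.D-token q in Z , st , proj₂ ∘ ∈-remove X ∘ sub , r
        spread : ∀ {a b} → a ∈ D → b ∈ D → a ≢ b → Far a b
        spread a∈D b∈D a≢b with ∈-insert P.D a∈D | ∈-insert P.D b∈D
        ... | inj₁ refl | inj₁ refl = ⊥-elim (a≢b refl)
        ... | inj₁ refl | inj₂ q = far-d q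
        ... | inj₂ p | inj₁ refl = Far-sym (far-d p)
        ... | inj₂ p | inj₂ q = P.spread p q a≢b

  -- Assembling the five colour classes.

  private
    colour : (r d k s : Bool) → Fin 5
    colour false _ _ s = if s then # 1 else # 0
    colour true true _ _ = # 4
    colour true false k _ = if k then # 3 else # 2

  packing : HasPackingColoring G (1 ∷ 1 ∷ 2 ∷ 2 ∷ 3 ∷ [])
  packing = c , λ { i u v refl eq u≢v → ok u v u≢v (R u) (D u) (κ u) (f u) (R v) (D v) (κ v) (f v) refl refl refl refl refl refl refl refl (sym eq) }
    where
    f = proj₁ optimum
    R = proj₁ (proj₂ optimum)
    opt = proj₂ (proj₂ optimum)
    open Structure f R opt using (B-Cr)
    open Conflict f R opt
    open Peeling (peel (card R) R ≤-refl (λ p → p))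
    c : Fin n → Fin 5
    c v = colour (R v) (D v) (κ v) (f v)
    S = 1 ∷ 1 ∷ 2 ∷ 2 ∷ 3 ∷ []
    two-apart : ∀ {u v} → u ≢ v → ¬ Adj u v → DistanceAtLeast G 2 u v
    two-apart u≢v ¬a _ ((nil , _ , refl) , _) = ⊥-elim (u≢v refl)
    two-apart u≢v ¬a _ ((cons a nil , _ , refl) , _) = ⊥-elim (¬a a)
    two-apart u≢v ¬a _ ((cons _ (cons _ p) , _ , refl) , _) = s≤s (s≤s z≤n)
    three-apart : ∀ {u v} → u ≢ v → ¬ H u v → DistanceAtLeast G 3 u v
    three-apart u≢v ¬h _ ((nil , _ , refl) , _) = ⊥-elim (u≢v refl)
    three-apart u≢v ¬h _ ((cons a nil , _ , refl) , _) = ⊥-elim (¬h (u≢v , inj₁ a))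
    three-apart u≢v ¬h _ ((cons a (cons b nil) , _ , refl) , _) = ⊥-elim (¬h (u≢v , inj₂ (_ , a , b)))
    three-apart u≢v ¬h _ ((cons _ (cons _ (cons _ p)) , _ , refl) , _) = s≤s (s≤s (s≤s z≤n))
    four-apart : ∀ {u v} → u ≢ v → Far u v → DistanceAtLeast G 4 u v
    four-apart u≢v _ _ ((nil , _ , refl) , _) = ⊥-elim (u≢v refl)
    four-apart u≢v (¬a , _) _ ((cons a nil , _ , refl) , _) = ⊥-elim (¬a a)
    four-apart u≢v (_ , ¬c , _) _ ((cons a (cons b nil) , _ , refl) , _) = ⊥-elim (¬c (_ , a , b))
    four-apart u≢v (_ , _ , ¬t) _ ((cons a (cons b (cons d nil)) , _ , refl) , _) = ⊥-elim (¬t a b d)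
    four-apart u≢v _ _ ((cons _ (cons _ (cons _ (cons _ p))) , _ , refl) , _) = s≤s (s≤s (s≤s (s≤s z≤n)))
    independent : ∀ {u v s} → u ≢ v → u ∉ R → v ∉ R → f u ≡ s → f v ≡ s → DistanceAtLeast G 2 u v
    independent u≢v u∉R v∉R fu fv = two-apart u≢v (λ a → proj₂ (B-Cr u∉R v∉R a) (trans fu (sym fv)))
    ok : ∀ u v → u ≢ v → ∀ r d k s r' d' k' s' → R u ≡ r → D u ≡ d → κ u ≡ k → f u ≡ s → R v ≡ r' → D v ≡ d' → κ v ≡ k' → f v ≡ s' →
         colour r d k s ≡ colour r' d' k' s' → DistanceAtLeast G (suc (lookup S (colour r d k s))) u v
    ok u v u≢v false _ _ false false _ _ false ru _ _ fu rv _ _ fv _ = independent u≢v ru rv fu fv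
    ok u v u≢v false _ _ true false _ _ true ru _ _ fu rv _ _ fv _ = independent u≢v ru rv fu fv
    ok u v u≢v true true _ _ true true _ _ ru du _ _ rv dv _ _ _ = four-apart u≢v (spread du dv u≢v)
    ok u v u≢v true false false _ true false false _ ru du ku _ rv dv kv _ _ = three-apart u≢v (λ h → proper ru rv du dv h (trans ku (sym kv)))
    ok u v u≢v true false true _ true false true _ ru du ku _ rv dv kv _ _ = three-apart u≢v (λ h → proper ru rv du dv h (trans ku (sym kv)))
    ok u v u≢v false _ _ false false _ _ true _ _ _ _ _ _ _ _ ()
    ok u v u≢v false _ _ true false _ _ false _ _ _ _ _ _ _ _ ()
    ok u v u≢v false _ _ false true true _ _ _ _ _ _ _ _ _ _ ()
    ok u v u≢v false _ _ true true true _ _ _ _ _ _ _ _ _ _ ()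
    ok u v u≢v false _ _ false true false false _ _ _ _ _ _ _ _ _ ()
    ok u v u≢v false _ _ false true false true _ _ _ _ _ _ _ _ _ ()
    ok u v u≢v false _ _ true true false false _ _ _ _ _ _ _ _ _ ()
    ok u v u≢v false _ _ true true false true _ _ _ _ _ _ _ _ _ ()
    ok u v u≢v true true _ _ false _ _ false _ _ _ _ _ _ _ _ ()
    ok u v u≢v true true _ _ false _ _ true _ _ _ _ _ _ _ _ ()
    ok u v u≢v true true _ _ true false false _ _ _ _ _ _ _ _ _ ()
    ok u v u≢v true true _ _ true false true _ _ _ _ _ _ _ _ _ ()
    ok u v u≢v true false false _ false _ _ false _ _ _ _ _ _ _ _ ()
    ok u v u≢v true false false _ false _ _ true _ _ _ _ _ _ _ _ ()
    ok u v u≢v true false true _ false _ _ false _ _ _ _ _ _ _ _ ()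
    ok u v u≢v true false true _ false _ _ true _ _ _ _ _ _ _ _ ()
    ok u v u≢v true false false _ true true _ _ _ _ _ _ _ _ _ _ ()
    ok u v u≢v true false true _ true true _ _ _ _ _ _ _ _ _ _ ()
    ok u v u≢v true false false _ true false true _ _ _ _ _ _ _ _ _ ()
    ok u v u≢v true false true _ true false false _ _ _ _ _ _ _ _ _ ()

∣tabulate∣ : (b : Fin n → Bool) → ∣ tabulate b ∣ ≡ card b
∣tabulate∣ {zero} b = refl
∣tabulate∣ {suc n} b with b zero
... | true = cong suc (∣tabulate∣ (b ∘ suc))
... | false = ∣tabulate∣ (b ∘ suc)

subcubic-degree : (G : Graph n) → Subcubic G → ∀ v → sum (λ w → ⟦ Graph.adj? G v w ⟧) ≤ 3
subcubic-degree {n} G sub v = ≤-trans (≤-reflexive (sym (∣tabulate∣ (λ w → does (Graph.adj? G v w)))))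
  (≤-trans (All.lookup (xs≤max 0 (List.map (degree G) (List.allFin n))) (∈-map⁺ (degree G) (∈-allFin v))) sub)

theorem1p2 : (n : ℕ) (G : Graph n) → Subcubic G → HasPackingColoring G (1 ∷ 1 ∷ 2 ∷ 2 ∷ 3 ∷ [])
theorem1p2 n G sub = Cubic.packing G (subcubic-degree G sub)
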